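{- Let $n\ge 2$ be even. The partition function for the strip of hexagons with $n$ black nodes on the torus, considering only $z$, is $$\mathcal P_n^{\mathrm{hex}}(z)=z^{n/2}\sum_{p=0}^{n}(-1)^p z^{ -p}a_{n,p}=z^{n/2}\,Q_n(-1/z)=\frac{z^{n/2}}{2^n}\left[\left(1-\sqrt{1-\tfrac4z}\right)^n+\left(1+\sqrt{1-\tfrac4z}\right)^n\right],$$ where $a_{n,p}=\frac{n}{n-p}\binom{n-p}{p}$ (read as $0$ for $p>n/2$) and $Q_n$ is the monomer-dimer partition function of the cycle with $n$ nodes.
   Context: Strip of squares. For even $n\ge2$, the strip of squares $\mathcal G_{2,n}$ on the torus is the multigraph with $2n$ nodes $(r,j)$, $r\in\mathbb Z/2$ (row; $r=0$ bottom, $r=1$ top), $j\in\mathbb Z/n$ (column). Node $(r,j)$ is black if $r+j$ is even and white otherwise, so there are $n$ black nodes. There are $4n$ distinct edges (parallel edges count as different): horizontal edges $h_{r,j}$ joining $(r,j)$ and $(r,j+1)$, and vertical edges $v_{r,j}$ joining $(r,j)$ and $(r+1,j)$, where $v_{r,j}$ is thought of as going upwards from $(r,j)$; thus $v_{0,j}$ is internal and $v_{1,j}$ crosses the cycle $z$ of the torus. Strip of hexagons. It is obtained from $\mathcal G_{2,n}$ by deleting half of the vertical edges, namely all $v_{r,j}$ with $(r,j)$ white; so each black node keeps its left, right and up edges. Weights. A perfect matching is a set of edges touching each node exactly once. Edges are directed from black to white. The $z$-weight $n_z$ of a matching $M$ is the sum over edges $v_{1,j}\in M$ of $+1$ if $(1,j)$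 is black and $-1$ if $(1,j)$ is white. The $w$-weight $n_w$ of $M$ is the sum over edges $h_{r,n-1}\in M$ (those crossing the cycle $w$) of $+1$ if $(r,n-1)$ is black and $-1$ if $(r,n-1)$ is white. Partition functions. The full partition function (Newton polynomial) is $\sum_{n_z,n_w}N_{n_z,n_w}(-1)^{n_z+n_w+n_zn_w}z^{n_z}w^{n_w}$, where $N_{n_z,n_w}$ is the number of perfect matchings of weight $(n_z,n_w)$. The partition function considering only $z$, $\mathcal P_n^{\mathrm{hex}}(z)$, is its $w^0$ part, for the strip of hexagons. Monomer-dimer system. $Q_n(q)=\sum_{p}a_{n,p}q^p$, where $a_{n,p}$ is the number of (not necessarily perfect) matchings with exactly $p$ edges in the cycle with $n$ nodes and $n$ edges (for $n=2$: two nodes joined by two distinct parallel edges); $a_{n,p}$ is also the number of perfect matchings of the strip of hexagons with $z$-weight $n/2-p$ (and $n_w=0$).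
   Formalization: With the stated sign convention the first equality holds only up to the factor (-1)^{n/2} (for n=2 the partition function is 2-z, the formula gives z-2); the formal theorem inserts this factor in the first equality, and the other equalities are as displayed. -}

module Defs where

open import Algebra.Bundles using (CommutativeRing; Semiring)
open import Data.Fin.Base using (Fin; zero; suc; toℕ)
import Data.Fin.Properties as Fin
open import Data.Integer.Base as ℤ using (ℤ; +_; -[1+_]; 0ℤ; 1ℤ; -1ℤ)
import Data.Integer.Properties as ℤ
open import Data.List.Base
  using (List; []; _∷_; _++_; map; concatMap; filter; foldr; length; allFin; upTo)
open import Data.List.Relation.Unary.All using (All; all?)
open import Data.Nat.Base as ℕ using (ℕ; zero; suc)
open import Data.Nat.Divisibility using (_∣_; _∣?_)
open import Data.Nat.DivMod using (_mod_)
import Data.Nat.Properties as ℕ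
open import Data.Product.Base using (_×_; _,_; proj₁; proj₂)
open import Data.Product.Properties using (≡-dec)
open import Data.Sum.Base using (_⊎_)
open import Data.Unit.Base using (⊤; tt)
open import Relation.Binary.Definitions using (DecidableEquality)
open import Relation.Binary.PropositionalEquality using (_≡_)
open import Relation.Nullary using (yes; no)
open import Relation.Nullary.Decidable using (_×-dec_; _⊎-dec_)
open import Relation.Unary using (Decidable)

-- If xs has no repetitions, this lists every subset of xs exactly once.
sublists : ∀ {A : Set} → List A → List (List A)
sublists []       = [] ∷ []
sublists (x ∷ xs) = map (x ∷_) (sublists xs) ++ sublists xs

-- A finite multigraph.  Both lists are meant to be free of repetitions, so
-- that the sets of edges are the elements of `sublists edges`; parallel edges
-- are different elements of Edge with the same end points.
record Multigraph : Set₁ where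
  field
    Node      : Set
    Edge      : Set
    _≟_       : DecidableEquality Node
    nodes     : List Node
    edges     : List Edge
    endpoints : Edge → Node × Node

  Touches : Node → Edge → Set
  Touches x e = proj₁ (endpoints e) ≡ x ⊎ proj₂ (endpoints e) ≡ x

  touches? : ∀ x → Decidable (Touches x)
  touches? x e = (proj₁ (endpoints e) ≟ x) ⊎-dec (proj₂ (endpoints e) ≟ x)

  degree : List Edge → Node → ℕ
  degree M x = length (filter (touches? x) M)

  IsMatching : List Edge → Set
  IsMatching M = All (λ x → degree M x ℕ.≤ 1) nodes

  isMatching? : Decidable IsMatching
  isMatching? M = all? (λ x → degree M x ℕ.≤? 1) nodes

  IsPerfectMatching : List Edge → Set
  IsPerfectMatching M = All (λ x → degree M x ≡ 1) nodes

  isPerfectMatching? : Decidable IsPerfectMatching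
  isPerfectMatching? M = all? (λ x → degree M x ℕ.≟ 1) nodes

  matchings : List (List Edge)
  matchings = filter isMatching? (sublists edges)

  perfectMatchings : List (List Edge)
  perfectMatchings = filter isPerfectMatching? (sublists edges)

-- j ↦ j + 1 in ℤ/n
next : ∀ {n} → Fin n → Fin n
next {suc n} j = suc (toℕ j) mod suc n

------------------------------------------------------------------------
-- Strips on the torus

StripNode : ℕ → Set
StripNode n = Fin 2 × Fin n

Black : ∀ {n} → StripNode n → Set
Black (r , j) = 2 ∣ toℕ r ℕ.+ toℕ j

black? : ∀ {n} → Decidable (Black {n})
black? (r , j) = 2 ∣? toℕ r ℕ.+ toℕ j

data StripEdge (n : ℕ) : Set where
  h v : Fin 2 → Fin n → StripEdge n

stripEndpoints : ∀ {n} → StripEdge n → StripNode n × StripNode n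
stripEndpoints (h r j) = (r , j) , (r , next j)
stripEndpoints (v r j) = (r , j) , (next r , j)

-- Only v r j with (r , j) white are deleted for the strip of hexagons.
Hexagonal : ∀ {n} → StripEdge n → Set
Hexagonal (h r j) = ⊤
Hexagonal (v r j) = Black (r , j)

hexagonal? : ∀ {n} → Decidable (Hexagonal {n})
hexagonal? (h r j) = yes tt
hexagonal? (v r j) = black? (r , j)

squareEdges : ∀ n → List (StripEdge n)
squareEdges n = concatMap
  (λ j → h zero j ∷ h (suc zero) j ∷ v zero j ∷ v (suc zero) j ∷ [])
  (allFin n)

hexagonEdges : ∀ n → List (StripEdge n)
hexagonEdges n = filter hexagonal? (squareEdges n)

strip : ∀ n → List (StripEdge n) → Multigraph
strip n E = record
  { Node      = StripNode n
  ; Edge      = StripEdge n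
  ; _≟_       = ≡-dec Fin._≟_ Fin._≟_
  ; nodes     = concatMap (λ j → (zero , j) ∷ (suc zero , j) ∷ []) (allFin n)
  ; edges     = E
  ; endpoints = stripEndpoints
  }

stripOfSquares : ℕ → Multigraph
stripOfSquares n = strip n (squareEdges n)

stripOfHexagons : ℕ → Multigraph
stripOfHexagons n = strip n (hexagonEdges n)

orientation : ∀ {n} → StripNode n → ℤ
orientation x with black? x
... | yes _ = 1ℤ
... | no  _ = -1ℤ

zWeightOf : ∀ {n} → StripEdge n → ℤ
zWeightOf (h r j)          = 0ℤ
zWeightOf (v zero j)       = 0ℤ
zWeightOf (v (suc zero) j) = orientation (suc zero , j)

wWeightOf : ∀ {n} → StripEdge n → ℤ
wWeightOf {n} (h r j) with suc (toℕ j) ℕ.≟ n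
... | yes _ = orientation (r , j)
... | no  _ = 0ℤ
wWeightOf (v r j) = 0ℤ

sumℤ : List ℤ → ℤ
sumℤ = foldr ℤ._+_ 0ℤ

zWeight wWeight : ∀ {n} → List (StripEdge n) → ℤ
zWeight M = sumℤ (map zWeightOf M)
wWeight M = sumℤ (map wWeightOf M)

N : ∀ n → List (StripEdge n) → ℤ → ℤ → ℕ
N n E i j = length (filter (λ M → (zWeight M ℤ.≟ i) ×-dec (wWeight M ℤ.≟ j))
                           (Multigraph.perfectMatchings (strip n E)))

------------------------------------------------------------------------
-- Partition functions

-- Finite formal sums of monomials; (c , i) stands for c zⁱ and
-- (c , i , j) for c zⁱ wʲ.
Laurent₁ Laurent₂ : Set
Laurent₁ = List (ℤ × ℤ)
Laurent₂ = List (ℤ × ℤ × ℤ)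

wConstantPart : Laurent₂ → Laurent₁
wConstantPart P = map (λ (c , i , _) → c , i) (filter (λ (_ , _ , j) → j ℤ.≟ 0ℤ) P)

-- (-1)^k depends only on ∣ k ∣.
sign : ℤ → ℤ
sign k = -1ℤ ℤ.^ ℤ.∣ k ∣

-- The integers from -n to n.
symmetricRange : ℕ → List ℤ
symmetricRange n = map (λ k → + k ℤ.- + n) (upTo (suc (2 ℕ.* n)))

-- Only the n edges v 1 j and the two edges h r (n-1) have a nonzero weight,
-- so for n ≥ 2 all weights (n_z , n_w) occurring lie in [-n , n]².
partitionFunction : ∀ n → List (StripEdge n) → Laurent₂
partitionFunction n E =
  concatMap
    (λ i → map (λ j → sign (i ℤ.+ j ℤ.+ i ℤ.* j) ℤ.* + N n E i j , i , j)
               (symmetricRange n))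
    (symmetricRange n)

Phex : ℕ → Laurent₁
Phex n = wConstantPart (partitionFunction n (hexagonEdges n))

------------------------------------------------------------------------
-- Monomer-dimer system

-- Edge j joins j and j + 1.
cycle : ℕ → Multigraph
cycle n = record
  { Node      = Fin n
  ; Edge      = Fin n
  ; _≟_       = Fin._≟_
  ; nodes     = allFin n
  ; edges     = allFin n
  ; endpoints = λ j → j , next j
  }

a : ℕ → ℕ → ℕ
a n p = length (filter (λ M → length M ℕ.≟ p) (Multigraph.matchings (cycle n)))

------------------------------------------------------------------------
-- Values in a commutative ring

module Evaluation {c ℓ} (R : CommutativeRing c ℓ) where

  open CommutativeRing R public
    using (Carrier; _≈_; _+_; _*_; _-_; 0#; 1#)
    renaming (-_ to neg)
  open import Algebra.Definitions.RawSemiring (Semiring.rawSemiring (CommutativeRing.semiring R)) public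
    using (_^_; sum) renaming (_×_ to _·_)

  fromℤ : ℤ → Carrier
  fromℤ (+ k)    = k · 1#
  fromℤ -[1+ k ] = neg (suc k · 1#)

  -- zⁱ for z with inverse z⁻¹
  power : (z z⁻¹ : Carrier) → ℤ → Carrier
  power z z⁻¹ (+ k)    = z ^ k
  power z z⁻¹ -[1+ k ] = z⁻¹ ^ suc k

  eval : Laurent₁ → (z z⁻¹ : Carrier) → Carrier
  eval P z z⁻¹ = foldr (λ (c , i) s → fromℤ c * power z z⁻¹ i + s) 0# P

  -- The cycle has n edges, so a n p = 0 for p > n.
  Q : ℕ → Carrier → Carrier
  Q n q = sum {suc n} (λ p → (a n (toℕ p) · 1#) * q ^ toℕ p)

{-# OPTIONS --safe #-}

-- Each column of the strip of hexagons has exactly one vertical edge.  A perfect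
-- matching with n_w = 0 has the same horizontal edges in both rows: this holds at
-- the cycle w, and perfectness carries it from column to column.  Hence it is a
-- matching M of the cycle with n nodes, the uncovered columns being filled by
-- their vertical edges; each pair of columns 2i, 2i+1 contains one edge of M or
-- one vertical edge across z, so that n_z = n/2 - ∣M∣.  Removing an edge from
-- the cycle turns its matchings into matchings of paths, counted by binomial
-- coefficients.  Pascal's rule then makes Q_n(q) satisfy the Lucas recurrence
-- u (n+2) = u (n+1) + q u n, whose characteristic roots at q = -1/z are
-- (1 ± √(1 - 4/z)) / 2.

module Submission where

open import Defs
open import Algebra.Bundles using (CommutativeRing)
open import Data.Bool.Base using (if_then_else_)
open import Data.Fin.Base using (Fin; zero; suc; toℕ; fromℕ; fromℕ<)
import Data.Fin.Permutation as Perm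
import Data.Fin.Properties as Fin
open import Data.Integer.Base as ℤ using (ℤ; +_; -[1+_]; 0ℤ; 1ℤ; -1ℤ; _⊖_)
import Data.Integer.Properties as ℤ
open import Data.List.Base
  using (List; []; _∷_; _++_; _∷ʳ_; map; concatMap; filter; foldr; length; allFin; tabulate; upTo; applyUpTo)
open import Data.List.Membership.DecPropositional using (_∈?_)
open import Data.List.Membership.Propositional using (_∈_; _∉_; find; lose)
open import Data.List.Membership.Propositional.Properties
  using (∈-map⁺; ∈-map⁻; ∈-++⁺ˡ; ∈-++⁺ʳ; ∈-++⁻; ∈-filter⁺; ∈-filter⁻; ∈-allFin; ∈-upTo⁺; ∈-concatMap⁺)
open import Data.List.Membership.Propositional.Properties.WithK using (unique∧set⇒bag)
import Data.List.Properties as List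
open import Data.List.Relation.Binary.BagAndSetEquality using (∼bag⇒↭)
open import Data.List.Relation.Binary.Disjoint.Propositional using (Disjoint)
open import Data.List.Relation.Binary.Permutation.Propositional.Properties using (↭-length)
open import Data.List.Relation.Binary.Sublist.Propositional
  using (_⊆_; []; _∷_) renaming (_∷ʳ_ to skip)
open import Data.List.Relation.Binary.Sublist.Propositional.Properties
  using (Any-resp-⊆; All-resp-⊆; filter-⊆)
open import Data.List.Relation.Unary.All as All using ([]; _∷_)
import Data.List.Relation.Unary.All.Properties as All
open import Data.List.Relation.Unary.AllPairs as AllPairs using (AllPairs; []; _∷_; allPairs?)
import Data.List.Relation.Unary.AllPairs.Properties as AllPairs
open import Data.List.Relation.Unary.Any using (Any; here; there; any?)
open import Data.List.Relation.Unary.Unique.Propositional using (Unique)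
import Data.List.Relation.Unary.Unique.Propositional.Properties as Unique
open import Data.Nat.Base as ℕ using (ℕ; zero; suc; z≤n; s≤s; NonZero)
open import Data.Nat.Combinatorics using (_C_; k>n⇒nCk≡0; nCk+nC[k+1]≡[n+1]C[k+1])
open import Data.Nat.Divisibility using (_∣_; divides; ∣m+n∣m⇒∣n; ∣1⇒≡1; ∣m∣n⇒∣m+n; ∣-refl)
open import Data.Nat.DivMod using (m%n<n; m<n⇒m%n≡m; n%n≡0; m*n/n≡m)
import Data.Nat.Properties as ℕ
import Data.Nat.Solver as ℕ
open import Data.Product.Base using (∃; _×_; _,_; proj₁; proj₂)
import Data.Rational.Base as ℚ
import Data.Rational.Properties as ℚ
import Data.Rational.Unnormalised.Base as ℚᵘ
import Data.Rational.Unnormalised.Properties as ℚᵘ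
open import Data.Sum.Base using (_⊎_; inj₁; inj₂)
open import Function.Base using (_∘_; id)
open import Function.Bundles using (mk⇔)
open import Level using (0ℓ)
open import Relation.Binary.Core using (Rel)
open import Relation.Binary.Definitions using (DecidableEquality)
open import Relation.Binary.PropositionalEquality
  using (_≡_; _≢_; refl; sym; trans; cong; cong₂; subst; module ≡-Reasoning)
open import Relation.Nullary using (¬_; yes; no; does; contradiction)
open import Relation.Nullary.Decidable using (_×-dec_; ¬?; map′)
open import Relation.Unary using (Pred; Decidable)

-- A set of edges is a sublist of a fixed list without repetitions, so two sets with the same
-- members are equal as lists. The correspondence between cycle matchings and perfect matchings of
-- the strip can therefore be given by two filters that are inverse to each other up to `≡`, and
-- equality of cardinalities becomes equality of members.
--
-- The sign of a monomial with `n_w = 0` is (-1)^n_z, and n_z = n/2 - p splits it into (-1)^(n/2)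
-- and (-1)^p. Only the second factor belongs to the sum over p. With the stated sign convention the
-- partition function thus equals the displayed formula up to the global sign (-1)^(n/2), which the
-- formal statement carries as `neg 1# ^ n/2`.
--
-- The identities between Laurent polynomials are stated as identities of values at an invertible
-- `z` in an arbitrary commutative ring; one half and the square root enter as elements `½` and `s`
-- given by their defining equations.

private
  variable
    A B : Set
    x y : A
    xs M K : List A
    P P′ : Pred A 0ℓ

-- Sublists

∈-sublists⁺ : M ⊆ xs → M ∈ sublists xs
∈-sublists⁺ []                       = here refl
∈-sublists⁺ {xs = x ∷ xs} (skip _ τ)   = ∈-++⁺ʳ (map (x ∷_) (sublists xs)) (∈-sublists⁺ τ)
∈-sublists⁺ (refl ∷ τ)               = ∈-++⁺ˡ (∈-map⁺ _ (∈-sublists⁺ τ))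

∈-sublists⁻ : ∀ (xs : List A) → M ∈ sublists xs → M ⊆ xs
∈-sublists⁻ []       (here refl) = []
∈-sublists⁻ (x ∷ xs) M∈ with ∈-++⁻ (map (x ∷_) (sublists xs)) M∈
... | inj₂ M∈xs = skip x (∈-sublists⁻ xs M∈xs)
... | inj₁ M∈map with ∈-map⁻ (x ∷_) M∈map
...   | _ , M′∈xs , refl = refl ∷ ∈-sublists⁻ xs M′∈xs

sublists-unique : Unique xs → Unique (sublists xs)
sublists-unique [] = [] ∷ []
sublists-unique {xs = x ∷ xs} u@(_ ∷ xs!) =
  Unique.++⁺ (Unique.map⁺ List.∷-injectiveʳ ih) ih disjoint
  where
  ih = sublists-unique xs!
  disjoint : ∀ {M} → ¬ (M ∈ map (x ∷_) (sublists xs) × M ∈ sublists xs)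
  disjoint (M∈map , M∈xs) with ∈-map⁻ (x ∷_) M∈map
  ... | _ , _ , refl =
    Unique.Unique[x∷xs]⇒x∉xs u (Any-resp-⊆ (∈-sublists⁻ xs M∈xs) (here refl))

AllPairs-resp-⊆ : {R : Rel A 0ℓ} → M ⊆ xs → AllPairs R xs → AllPairs R M
AllPairs-resp-⊆ []         []         = []
AllPairs-resp-⊆ (skip _ τ)   (_ ∷ rs)   = AllPairs-resp-⊆ τ rs
AllPairs-resp-⊆ (refl ∷ τ) (r ∷ rs)   = All-resp-⊆ τ r ∷ AllPairs-resp-⊆ τ rs

-- Both sublists inherit the order of `xs`, in which each element occurs once, so the members leave
-- no freedom. This is what makes lists behave as sets below.
⊆-extensional : Unique xs → M ⊆ xs → K ⊆ xs →
                (∀ {x} → x ∈ M → x ∈ K) → (∀ {x} → x ∈ K → x ∈ M) → M ≡ K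
⊆-extensional _ [] [] _ _ = refl
⊆-extensional (_ ∷ xs!) (skip _ σ) (skip _ τ) f g = ⊆-extensional xs! σ τ f g
⊆-extensional u (skip _ σ) (refl ∷ τ) f g =
  contradiction (Any-resp-⊆ σ (g (here refl))) (Unique.Unique[x∷xs]⇒x∉xs u)
⊆-extensional u (refl ∷ σ) (skip _ τ) f g =
  contradiction (Any-resp-⊆ τ (f (here refl))) (Unique.Unique[x∷xs]⇒x∉xs u)
⊆-extensional u@(_ ∷ xs!) (refl ∷ σ) (refl ∷ τ) f g =
  cong (_ ∷_) (⊆-extensional xs! σ τ (λ x∈ → drop-head σ x∈ (f (there x∈)))
                                     (λ x∈ → drop-head τ x∈ (g (there x∈))))
  where
  drop-head : ∀ {L N x} → L ⊆ _ → x ∈ L → x ∈ _ ∷ N → x ∈ N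
  drop-head ρ x∈L (there x∈N) = x∈N
  drop-head ρ x∈L (here refl) =
    contradiction (Any-resp-⊆ ρ x∈L) (Unique.Unique[x∷xs]⇒x∉xs u)

AllPairs-map-∈ : {R S : Rel A 0ℓ} → (∀ {x y} → x ∈ xs → y ∈ xs → R x y → S x y) →
                 AllPairs R xs → AllPairs S xs
AllPairs-map-∈ f []       = []
AllPairs-map-∈ f (r ∷ rs) =
  All.tabulate (λ y∈ → f (here refl) (there y∈) (All.lookup r y∈))
  ∷ AllPairs-map-∈ (λ x∈ y∈ → f (there x∈) (there y∈)) rs

AllPairs-lookup : {R : Rel A 0ℓ} → AllPairs R xs → x ∈ xs → y ∈ xs → x ≡ y ⊎ R x y ⊎ R y x
AllPairs-lookup (r ∷ rs) (here refl) (here refl) = inj₁ refl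
AllPairs-lookup (r ∷ rs) (here refl) (there y∈)  = inj₂ (inj₁ (All.lookup r y∈))
AllPairs-lookup (r ∷ rs) (there x∈)  (here refl) = inj₂ (inj₂ (All.lookup r x∈))
AllPairs-lookup (r ∷ rs) (there x∈)  (there y∈)  = AllPairs-lookup rs x∈ y∈

length≤1⁺ : Unique xs → (∀ {x y} → x ∈ xs → y ∈ xs → x ≡ y) → length xs ℕ.≤ 1
length≤1⁺ {xs = []}         _ _ = z≤n
length≤1⁺ {xs = _ ∷ []}     _ _ = s≤s z≤n
length≤1⁺ {xs = _ ∷ _ ∷ _} ((x≢y ∷ _) ∷ _) f =
  contradiction (f (here refl) (there (here refl))) x≢y

length≤1⁻ : length xs ℕ.≤ 1 → x ∈ xs → y ∈ xs → x ≡ y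
length≤1⁻ {xs = _ ∷ []}    _        (here refl) (here refl) = refl
length≤1⁻ {xs = _ ∷ _ ∷ _} (s≤s ()) _           _

-- Degrees in a set of edges

module _ (G : Multigraph) where
  open Multigraph G

  -- The conclusion is equality of edges rather than of end points, so that parallel edges, which
  -- occur for `n = 2`, are covered by the same arguments.
  AtMostOne : List Edge → Node → Set
  AtMostOne M x = ∀ {e f} → e ∈ M → f ∈ M → Touches x e → Touches x f → e ≡ f

  degree≤1⁺ : ∀ {M x} → Unique M → AtMostOne M x → degree M x ℕ.≤ 1
  degree≤1⁺ {M} {x} M! one = length≤1⁺ (Unique.filter⁺ (touches? x) M!) λ e∈ f∈ →
    let e∈M , x∈e = ∈-filter⁻ (touches? x) e∈
        f∈M , x∈f = ∈-filter⁻ (touches? x) f∈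
    in one e∈M f∈M x∈e x∈f

  degree≤1⁻ : ∀ {M x} → degree M x ℕ.≤ 1 → AtMostOne M x
  degree≤1⁻ {M} {x} d≤1 e∈M f∈M x∈e x∈f =
    length≤1⁻ d≤1 (∈-filter⁺ (touches? x) e∈M x∈e) (∈-filter⁺ (touches? x) f∈M x∈f)

  degree≡1⁺ : ∀ {M x e} → Unique M → AtMostOne M x → e ∈ M → Touches x e → degree M x ≡ 1
  degree≡1⁺ {M} {x} M! one e∈M x∈e with filter (touches? x) M | degree≤1⁺ M! one | ∈-filter⁺ (touches? x) e∈M x∈e
  ... | _ ∷ []    | _       | _ = refl
  ... | _ ∷ _ ∷ _ | s≤s ()  | _

  degree≡1⁻ : ∀ {M x} → degree M x ≡ 1 → ∃ λ e → e ∈ M × Touches x e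
  degree≡1⁻ {M} {x} d≡1 with filter (touches? x) M in eq
  ... | e ∷ [] = e , ∈-filter⁻ (touches? x) (subst (e ∈_) (sym eq) (here refl))

-- Counting the sublists with a given property

filter-map : (P? : Decidable P) (f : A → B) (xs : List A) →
             filter P? (map f xs) ≡ map f (filter (P? ∘ f) xs)
filter-map P? f [] = refl
filter-map P? f (x ∷ xs) with P? (f x)
... | yes _ = cong (f x ∷_) (filter-map P? f xs)
... | no _  = filter-map P? f xs

length-filter-map : (P? : Decidable P) (f : A → B) (xs : List A) →
                    length (filter P? (map f xs)) ≡ length (filter (P? ∘ f) xs)
length-filter-map P? f xs =
  trans (cong length (filter-map P? f xs)) (List.length-map f (filter (P? ∘ f) xs))

length-filter-cong : (P? : Decidable P) (P′? : Decidable P′) (xs : List A) →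
                     (∀ {x} → x ∈ xs → P x → P′ x) → (∀ {x} → x ∈ xs → P′ x → P x) →
                     length (filter P? xs) ≡ length (filter P′? xs)
length-filter-cong P? P′? [] f g = refl
length-filter-cong P? P′? (x ∷ xs) f g
  with P? x | P′? x | length-filter-cong P? P′? xs (f ∘ there) (g ∘ there)
... | yes _ | yes _ | ih = cong suc ih
... | no  _ | no  _ | ih = ih
... | yes p | no ¬q | _  = contradiction (f (here refl) p) ¬q
... | no ¬p | yes q | _  = contradiction (g (here refl) q) ¬p

length-filter-filter : (P? : Decidable P) (P′? : Decidable P′) (xs : List A) →
  length (filter P? (filter P′? xs)) ≡ length (filter (λ x → P′? x ×-dec P? x) xs)
length-filter-filter P? P′? [] = refl
length-filter-filter P? P′? (x ∷ xs) with P′? x | length-filter-filter P? P′? xs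
... | no _  | ih = ih
... | yes _ | ih with P? x
...   | yes _ = cong suc ih
...   | no _  = ih

count : {P : Pred (List A) 0ℓ} → Decidable P → List A → ℕ
count P? xs = length (filter P? (sublists xs))

module _ {P : Pred (List A) 0ℓ} (P? : Decidable P) where

  count-∷ : ∀ x xs → count P? (x ∷ xs) ≡ count (P? ∘ (x ∷_)) xs ℕ.+ count P? xs
  count-∷ x xs = begin
    length (filter P? (map (x ∷_) (sublists xs) ++ sublists xs))
      ≡⟨ cong length (List.filter-++ P? (map (x ∷_) (sublists xs)) (sublists xs)) ⟩
    length (filter P? (map (x ∷_) (sublists xs)) ++ filter P? (sublists xs))
      ≡⟨ List.length-++ (filter P? (map (x ∷_) (sublists xs))) ⟩
    length (filter P? (map (x ∷_) (sublists xs))) ℕ.+ count P? xs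
      ≡⟨ cong (ℕ._+ count P? xs) (length-filter-map P? (x ∷_) (sublists xs)) ⟩
    count (P? ∘ (x ∷_)) xs ℕ.+ count P? xs
      ∎
    where open ≡-Reasoning

  count-none : ∀ xs → (∀ {M} → M ⊆ xs → ¬ P M) → count P? xs ≡ 0
  count-none xs ¬P = cong length
    (List.filter-none P? (All.tabulate (¬P ∘ ∈-sublists⁻ xs)))

count-cong : {P Q : Pred (List A) 0ℓ} (P? : Decidable P) (Q? : Decidable Q) (xs : List A) →
             (∀ {M} → M ⊆ xs → P M → Q M) → (∀ {M} → M ⊆ xs → Q M → P M) →
             count P? xs ≡ count Q? xs
count-cong P? Q? xs f g = length-filter-cong P? Q? (sublists xs)
  (f ∘ ∈-sublists⁻ xs) (g ∘ ∈-sublists⁻ xs)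

-- `sublists` branches on the head, but the edge that closes the cycle is the last one. Both
-- branchings give the same four classes of sublists, in a different order.
count-∷ʳ : {P : Pred (List A) 0ℓ} (P? : Decidable P) (xs : List A) (y : A) →
           count P? (xs ∷ʳ y) ≡ count (P? ∘ (_∷ʳ y)) xs ℕ.+ count P? xs
count-∷ʳ P? [] y = trans (count-∷ P? y []) (cong (ℕ._+ count P? [])
  (count-cong (P? ∘ (y ∷_)) (P? ∘ (_∷ʳ y)) [] (λ { [] p → p }) (λ { [] p → p })))
count-∷ʳ P? (x ∷ xs) y = begin
  count P? (x ∷ xs ∷ʳ y)
    ≡⟨ count-∷ P? x (xs ∷ʳ y) ⟩
  count (P? ∘ (x ∷_)) (xs ∷ʳ y) ℕ.+ count P? (xs ∷ʳ y)
    ≡⟨ cong₂ ℕ._+_ (count-∷ʳ (P? ∘ (x ∷_)) xs y) (count-∷ʳ P? xs y) ⟩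
  (count (P? ∘ (x ∷_) ∘ (_∷ʳ y)) xs ℕ.+ count (P? ∘ (x ∷_)) xs)
    ℕ.+ (count (P? ∘ (_∷ʳ y)) xs ℕ.+ count P? xs)
    ≡⟨ interchange (count (P? ∘ (x ∷_) ∘ (_∷ʳ y)) xs) _ _ _ ⟩
  (count (P? ∘ (_∷ʳ y) ∘ (x ∷_)) xs ℕ.+ count (P? ∘ (_∷ʳ y)) xs)
    ℕ.+ (count (P? ∘ (x ∷_)) xs ℕ.+ count P? xs)
    ≡⟨ cong₂ ℕ._+_ (count-∷ (P? ∘ (_∷ʳ y)) x xs) (count-∷ P? x xs) ⟨
  count (P? ∘ (_∷ʳ y)) (x ∷ xs) ℕ.+ count P? (x ∷ xs)
    ∎
  where
  open ≡-Reasoning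
  open import Algebra.Properties.CommutativeSemigroup ℕ.+-commutativeSemigroup using (interchange)

sublists-map : (f : A → B) (xs : List A) → sublists (map f xs) ≡ map (map f) (sublists xs)
sublists-map f [] = refl
sublists-map f (x ∷ xs) = begin
  map (f x ∷_) (sublists (map f xs)) ++ sublists (map f xs)
    ≡⟨ cong (λ L → map (f x ∷_) L ++ L) (sublists-map f xs) ⟩
  map (f x ∷_) (map (map f) (sublists xs)) ++ map (map f) (sublists xs)
    ≡⟨ cong (_++ map (map f) (sublists xs))
         (trans (sym (List.map-∘ (sublists xs))) (List.map-∘ (sublists xs))) ⟩
  map (map f) (map (x ∷_) (sublists xs)) ++ map (map f) (sublists xs)
    ≡⟨ List.map-++ (map f) (map (x ∷_) (sublists xs)) (sublists xs) ⟨
  map (map f) (map (x ∷_) (sublists xs) ++ sublists xs)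
    ∎
  where open ≡-Reasoning

count-map : {P : Pred (List B) 0ℓ} (P? : Decidable P) (f : A → B) (xs : List A) →
            count P? (map f xs) ≡ count (P? ∘ map f) xs
count-map P? f xs = trans (cong (length ∘ filter P?) (sublists-map f xs))
                          (length-filter-map P? (map f) (sublists xs))

-- Matchings of the cycle

interval : ℕ → ℕ → List ℕ
interval k zero    = []
interval k (suc m) = k ∷ interval (suc k) m

interval-∷ʳ : ∀ k m → interval k (suc m) ≡ interval k m ∷ʳ (k ℕ.+ m)
interval-∷ʳ k zero    = cong (_∷ []) (sym (ℕ.+-identityʳ k))
interval-∷ʳ k (suc m) = cong (k ∷_)
  (trans (interval-∷ʳ (suc k) m) (cong (interval (suc k) m ∷ʳ_) (sym (ℕ.+-suc k m))))

∈-interval⁻ : ∀ {i} k m → i ∈ interval k m → k ℕ.≤ i × i ℕ.< k ℕ.+ m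
∈-interval⁻ k (suc m) (here refl) = ℕ.≤-refl , ℕ.m<m+n k (s≤s z≤n)
∈-interval⁻ {i} k (suc m) (there i∈) =
  let k<i , i<k+m = ∈-interval⁻ (suc k) m i∈
  in ℕ.<⇒≤ k<i , subst (i ℕ.<_) (sym (ℕ.+-suc k m)) i<k+m

tabulate-toℕ : ∀ n (f : Fin n → ℕ) k → (∀ i → f i ≡ k ℕ.+ toℕ i) → tabulate f ≡ interval k n
tabulate-toℕ zero    f k eq = refl
tabulate-toℕ (suc n) f k eq = cong₂ _∷_ (trans (eq zero) (ℕ.+-identityʳ k))
  (tabulate-toℕ n (f ∘ suc) (suc k) (λ i → trans (eq (suc i)) (ℕ.+-suc k (toℕ i))))

map-toℕ-allFin : ∀ n → map toℕ (allFin n) ≡ interval 0 n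
map-toℕ-allFin n = trans (List.map-tabulate id toℕ) (tabulate-toℕ n toℕ 0 (λ _ → refl))

-- Edge `i` joins the nodes `i` and `i + 1`, so edges `i < j` of a path are disjoint exactly when
-- `2 + i ≤ j`. Natural numbers instead of `Fin` allow the path to start anywhere.
Sparse : List ℕ → Set
Sparse = AllPairs (λ i j → 2 ℕ.+ i ℕ.≤ j)

sparse? : Decidable Sparse
sparse? = allPairs? (λ i j → 2 ℕ.+ i ℕ.≤? j)

SparseOfSize : ℕ → List ℕ → Set
SparseOfSize p M = Sparse M × length M ≡ p

sparseOfSize? : ∀ p → Decidable (SparseOfSize p)
sparseOfSize? p M = sparse? M ×-dec (length M ℕ.≟ p)

-- Edge `k` excludes edge `suc k` and puts no constraint on the edges from `2 + k` on. The
-- predecessor accounts for the excluded edge and stays at `0` if there is none.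
count-sparse-∷ : ∀ k m p → count (sparseOfSize? (suc p) ∘ (k ∷_)) (interval (suc k) m)
                         ≡ count (sparseOfSize? p) (interval (2 ℕ.+ k) (ℕ.pred m))
count-sparse-∷ k m p = trans (drop-first m) (count-cong _ _ (interval (2 ℕ.+ k) (ℕ.pred m))
  (λ { _ (_ ∷ s , l) → s , ℕ.suc-injective l })
  (λ τ (s , l) → All.tabulate (λ i∈ → proj₁ (∈-interval⁻ _ (ℕ.pred m) (Any-resp-⊆ τ i∈))) ∷ s
               , cong suc l))
  where
  Q? = sparseOfSize? (suc p) ∘ (k ∷_)
  drop-first : ∀ m → count Q? (interval (suc k) m) ≡ count Q? (interval (2 ℕ.+ k) (ℕ.pred m))
  drop-first zero    = refl
  drop-first (suc m) = trans (count-∷ Q? (suc k) (interval (2 ℕ.+ k) m))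
    (cong (ℕ._+ count Q? (interval (2 ℕ.+ k) m)) (count-none (Q? ∘ (suc k ∷_)) (interval (2 ℕ.+ k) m)
      λ { _ ((2+k≤1+k ∷ _) ∷ _ , _) → ℕ.<-irrefl refl 2+k≤1+k }))

[0∸p]C[1+p]≡0 : ∀ p → (0 ℕ.∸ p) C suc p ≡ 0
[0∸p]C[1+p]≡0 p rewrite ℕ.0∸n≡0 p = k>n⇒nCk≡0 (s≤s (z≤n {p}))

-- C(m - p , p) is the number of p-edge matchings of a path with m nodes: either
-- the first edge is present, or the first node can be removed.
pathPascal : ∀ m p → (suc m ℕ.∸ p) C suc p ≡ (m ℕ.∸ p) C p ℕ.+ (m ℕ.∸ p) C suc p
pathPascal m p with p ℕ.≤? m
... | yes p≤m = begin
  (suc m ℕ.∸ p) C suc p                  ≡⟨ cong (_C suc p) (ℕ.+-∸-assoc 1 p≤m) ⟩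
  suc (m ℕ.∸ p) C suc p                  ≡⟨ nCk+nC[k+1]≡[n+1]C[k+1] (m ℕ.∸ p) p ⟨
  (m ℕ.∸ p) C p ℕ.+ (m ℕ.∸ p) C suc p    ∎
  where open ≡-Reasoning
-- Here `p` exceeds `m`: all truncated differences are `0`, and all lower indices are positive, so
-- every binomial coefficient vanishes.
... | no p≰m with p
...   | zero  = contradiction z≤n p≰m
...   | suc q
  rewrite ℕ.m≤n⇒m∸n≡0 (ℕ.≤-pred (ℕ.≰⇒> p≰m)) | ℕ.m≤n⇒m∸n≡0 (ℕ.<⇒≤ (ℕ.≰⇒> p≰m))
        | k>n⇒nCk≡0 (s≤s (z≤n {suc q})) | k>n⇒nCk≡0 (s≤s (z≤n {q})) = refl

-- Paths with one node and with no node both have only the empty matching. This repairs the case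
-- `m = 0`, in which `ℕ.pred m` does not drop below `0`.
[1∸p]Cp≡[0∸p]Cp : ∀ p → (1 ℕ.∸ p) C p ≡ (0 ℕ.∸ p) C p
[1∸p]Cp≡[0∸p]Cp zero    = refl
[1∸p]Cp≡[0∸p]Cp (suc p) = trans ([0∸p]C[1+p]≡0 p) (sym (k>n⇒nCk≡0 (s≤s (z≤n {p}))))

-- A path with `m` edges has `suc m` nodes, whence the shift in the binomial coefficient. The start
-- `k` is arbitrary because the recursion moves it by one or two.
count-sparse : ∀ k m p → count (sparseOfSize? p) (interval k m) ≡ (suc m ℕ.∸ p) C p
count-sparse k zero zero    = refl
count-sparse k zero (suc p) = sym ([0∸p]C[1+p]≡0 p)
count-sparse k (suc m) zero =
  trans (count-∷ (sparseOfSize? 0) k (interval (suc k) m))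
    (cong₂ ℕ._+_ (count-none (sparseOfSize? 0 ∘ (k ∷_)) (interval (suc k) m) (λ { _ (_ , ()) }))
                 (count-sparse (suc k) m zero))
count-sparse k (suc m) (suc p) =
  trans (count-∷ (sparseOfSize? (suc p)) k (interval (suc k) m))
    (trans (cong₂ ℕ._+_ (trans (count-sparse-∷ k m p) (ih m)) (count-sparse (suc k) m (suc p)))
           (sym (pathPascal m p)))
  where
  ih : ∀ m → count (sparseOfSize? p) (interval (2 ℕ.+ k) (ℕ.pred m)) ≡ (m ℕ.∸ p) C p
  ih zero    = trans (count-sparse (2 ℕ.+ k) zero p) ([1∸p]Cp≡[0∸p]Cp p)
  ih (suc m) = count-sparse (2 ℕ.+ k) m p

-- 0 and suc m are neighbours on the cycle with 2 + m nodes.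
CyclicallySparse : ℕ → ℕ → List ℕ → Set
CyclicallySparse m p M = (Sparse M × ¬ (0 ∈ M × suc m ∈ M)) × length M ≡ p

cyclicallySparse? : ∀ m p → Decidable (CyclicallySparse m p)
cyclicallySparse? m p M =
  (sparse? M ×-dec ¬? (_∈?_ ℕ._≟_ 0 M ×-dec _∈?_ ℕ._≟_ (suc m) M)) ×-dec (length M ℕ.≟ p)

-- Counts the p-edge matchings of the cycle with 2 + m nodes; those containing
-- edge 0 are matchings of a path with m nodes, the others of one with 2 + m nodes.
cycleCount : ℕ → ℕ → ℕ
cycleCount m zero    = 1
cycleCount m (suc p) = (m ℕ.∸ p) C p ℕ.+ (suc m ℕ.∸ p) C suc p

count-cyclicallySparse : ∀ m p →
  count (cyclicallySparse? m p) (interval 0 (2 ℕ.+ m)) ≡ cycleCount m p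
count-cyclicallySparse m p = trans (count-∷ P? 0 (interval 1 (suc m)))
  (trans (cong₂ ℕ._+_ (with-0 p) without-0) (combine p))
  where
  P? = cyclicallySparse? m p

  without-0 : count P? (interval 1 (suc m)) ≡ (2 ℕ.+ m ℕ.∸ p) C p
  without-0 = trans (count-cong P? (sparseOfSize? p) (interval 1 (suc m))
    (λ { _ ((s , _) , l) → s , l })
    (λ τ (s , l) → (s , λ (0∈ , _) →
       contradiction (proj₁ (∈-interval⁻ 1 (suc m) (Any-resp-⊆ τ 0∈))) λ ()) , l))
    (count-sparse 1 (suc m) p)

  0-count : ℕ → ℕ
  0-count zero    = 0
  0-count (suc p) = (m ℕ.∸ p) C p

  with-0 : ∀ p → count (cyclicallySparse? m p ∘ (0 ∷_)) (interval 1 (suc m)) ≡ 0-count p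
  with-0 zero    = count-none (cyclicallySparse? m 0 ∘ (0 ∷_)) (interval 1 (suc m)) λ { _ (_ , ()) }
  with-0 (suc p) = begin
    count Q? (interval 1 (suc m))
      -- Besides edge `1`, only the last edge `suc m` meets edge `0`. With it the wrap-around
      -- condition fails; without it that condition is vacuous, which leaves the edges of a path.
      ≡⟨ cong (count Q?) (interval-∷ʳ 1 m) ⟩
    count Q? (interval 1 m ∷ʳ suc m)
      ≡⟨ count-∷ʳ Q? (interval 1 m) (suc m) ⟩
    count (Q? ∘ (_∷ʳ suc m)) (interval 1 m) ℕ.+ count Q? (interval 1 m)
      ≡⟨ cong₂ ℕ._+_
          (count-none (Q? ∘ (_∷ʳ suc m)) (interval 1 m)
            λ {M} _ ((_ , wrap) , _) → wrap (here refl , there (∈-++⁺ʳ M (here refl))))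
          (count-cong Q? (sparseOfSize? (suc p) ∘ (0 ∷_)) (interval 1 m)
            (λ { _ ((s , _) , l) → s , l })
            (λ { τ (s , l) → (s , λ { (_ , there m∈) →
              ℕ.<-irrefl refl (proj₂ (∈-interval⁻ 1 m (Any-resp-⊆ τ m∈))) }) , l })) ⟩
    count (sparseOfSize? (suc p) ∘ (0 ∷_)) (interval 1 m)
      ≡⟨ count-sparse-∷ 0 m p ⟩
    count (sparseOfSize? p) (interval 2 (ℕ.pred m))
      ≡⟨ last m ⟩
    (m ℕ.∸ p) C p
      ∎
    where
    open ≡-Reasoning
    Q? = cyclicallySparse? m (suc p) ∘ (0 ∷_)
    last : ∀ m → count (sparseOfSize? p) (interval 2 (ℕ.pred m)) ≡ (m ℕ.∸ p) C p
    last zero    = trans (count-sparse 2 0 p) ([1∸p]Cp≡[0∸p]Cp p)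
    last (suc m) = count-sparse 2 m p

  combine : ∀ p → 0-count p ℕ.+ (2 ℕ.+ m ℕ.∸ p) C p ≡ cycleCount m p
  combine zero    = refl
  combine (suc p) = refl

-- Matchings of the cycle as cyclically sparse lists

toℕ-next : ∀ {n} (j : Fin n) →
  toℕ (next j) ≡ suc (toℕ j) ⊎ suc (toℕ j) ≡ n × toℕ (next j) ≡ 0
toℕ-next {suc n} j with suc (toℕ j) ℕ.<? suc n
... | yes j<n = inj₁ (trans (Fin.toℕ-fromℕ< (m%n<n (suc (toℕ j)) (suc n))) (m<n⇒m%n≡m j<n))
... | no  j≮n = inj₂ (last , trans (Fin.toℕ-fromℕ< (m%n<n (suc (toℕ j)) (suc n)))
                                   (trans (cong (ℕ._% suc n) last) (n%n≡0 (suc n))))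
  where last = ℕ.≤-antisym (Fin.toℕ<n j) (ℕ.≮⇒≥ j≮n)

next-injective : ∀ {n} {i j : Fin n} → next i ≡ next j → i ≡ j
next-injective {_} {i} {j} eq with toℕ-next i | toℕ-next j
... | inj₁ p | inj₁ q =
  Fin.toℕ-injective (ℕ.suc-injective (trans (sym p) (trans (cong toℕ eq) q)))
... | inj₁ p | inj₂ (_ , q) =
  contradiction (trans (sym p) (trans (cong toℕ eq) q)) λ ()
... | inj₂ (_ , p) | inj₁ q =
  contradiction (trans (sym q) (trans (cong toℕ (sym eq)) p)) λ ()
... | inj₂ (p , _) | inj₂ (q , _) = Fin.toℕ-injective (ℕ.suc-injective (trans p (sym q)))

next≢ : ∀ {n} → 2 ℕ.≤ n → (j : Fin n) → next j ≢ j
next≢ 2≤n j eq with toℕ-next j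
... | inj₁ p       = ℕ.1+n≢n (trans (sym p) (cong toℕ eq))
... | inj₂ (p , q) = contradiction 2≤n
  (ℕ.<⇒≱ (s≤s (ℕ.≤-reflexive (trans (sym p) (cong suc (trans (sym (cong toℕ eq)) q))))))

-- A sublist of `allFin` is strictly increasing, so a failure of sparseness means two consecutive
-- edges, which share the head of the first. Edges `0` and `suc m` share node `0`.
matching⇒sparse : ∀ {m} {M : List (Fin (2 ℕ.+ m))} → M ⊆ allFin (2 ℕ.+ m) →
  Multigraph.IsMatching (cycle (2 ℕ.+ m)) M →
  Sparse (map toℕ M) × ¬ (0 ∈ map toℕ M × suc m ∈ map toℕ M)
matching⇒sparse {m} {M} τ matching =
  AllPairs.map⁺ (AllPairs-map-∈ gap (AllPairs-resp-⊆ τ (AllPairs.tabulate⁺-< id))) , wrap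
  where
  one : ∀ x → AtMostOne (cycle (2 ℕ.+ m)) M x
  one x = degree≤1⁻ (cycle (2 ℕ.+ m)) (All.lookup matching (∈-allFin x))
  gap : ∀ {i j} → i ∈ M → j ∈ M → toℕ i ℕ.< toℕ j → 2 ℕ.+ toℕ i ℕ.≤ toℕ j
  gap {i} {j} i∈ j∈ i<j with toℕ-next i
  ... | inj₂ (p , _) = contradiction i<j (ℕ.≤⇒≯ (subst (toℕ j ℕ.≤_) (ℕ.suc-injective (sym p)) (ℕ.≤-pred (Fin.toℕ<n j))))
  ... | inj₁ p = ℕ.≤∧≢⇒< i<j λ eq → ℕ.<⇒≢ i<j (cong toℕ
      (one j i∈ j∈ (inj₂ (Fin.toℕ-injective (trans p eq))) (inj₁ refl)))
  wrap : ¬ (0 ∈ map toℕ M × suc m ∈ map toℕ M)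
  wrap (0∈ , m∈) with ∈-map⁻ toℕ 0∈ | ∈-map⁻ toℕ m∈
  ... | i , i∈ , 0≡i | j , j∈ , m≡j with toℕ-next j
  ...   | inj₁ p = contradiction (trans p (cong suc (sym m≡j))) (ℕ.<⇒≢ (Fin.toℕ<n (next j)))
  ...   | inj₂ (_ , p) = contradiction (trans 0≡i (trans (cong toℕ
             (one i i∈ j∈ (inj₁ refl) (inj₂ (Fin.toℕ-injective (trans p 0≡i))))) (sym m≡j))) λ ()

-- The only edges at a node are the one that starts there and the one that ends there, and `next`
-- takes the latter to the former. It therefore suffices that no edge and its successor both lie in
-- `M`.
sparse⇒matching : ∀ {m} {M : List (Fin (2 ℕ.+ m))} → M ⊆ allFin (2 ℕ.+ m) →
  Sparse (map toℕ M) → ¬ (0 ∈ map toℕ M × suc m ∈ map toℕ M) →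
  Multigraph.IsMatching (cycle (2 ℕ.+ m)) M
sparse⇒matching {m} {M} τ sparse wrap =
  All.tabulate λ _ → degree≤1⁺ (cycle (2 ℕ.+ m)) (AllPairs-resp-⊆ τ (Unique.allFin⁺ _)) one
  where
  ¬consecutive : ∀ {e} → e ∈ M → next e ∉ M
  ¬consecutive {e} e∈ ne∈ with toℕ-next e
  ... | inj₂ (p , q) = wrap (subst (_∈ map toℕ M) q (∈-map⁺ toℕ ne∈) ,
                             subst (_∈ map toℕ M) (ℕ.suc-injective p) (∈-map⁺ toℕ e∈))
  ... | inj₁ p with AllPairs-lookup sparse (∈-map⁺ toℕ e∈) (∈-map⁺ toℕ ne∈)
  ...   | inj₁ eq = ℕ.1+n≢n (trans (sym p) (sym eq))
  ...   | inj₂ (inj₁ lt) = ℕ.<-irrefl (sym p) lt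
  ...   | inj₂ (inj₂ lt) = ℕ.<-asym (ℕ.≤-trans (ℕ.n≤1+n _) lt) (ℕ.≤-reflexive (sym p))
  one : ∀ {x} → AtMostOne (cycle (2 ℕ.+ m)) M x
  one e∈ f∈ (inj₁ refl) (inj₁ refl) = refl
  one e∈ f∈ (inj₁ refl) (inj₂ refl) = contradiction e∈ (¬consecutive f∈)
  one e∈ f∈ (inj₂ refl) (inj₁ refl) = contradiction f∈ (¬consecutive e∈)
  one e∈ f∈ (inj₂ p)    (inj₂ q)    = next-injective (trans p (sym q))

a≡cycleCount : ∀ m p → a (2 ℕ.+ m) p ≡ cycleCount m p
a≡cycleCount m p = begin
  a n p
    ≡⟨ length-filter-filter (λ M → length M ℕ.≟ p) isMatching? (sublists (allFin n)) ⟩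
  count (λ M → isMatching? M ×-dec (length M ℕ.≟ p)) (allFin n)
    ≡⟨ count-cong _ (cyclicallySparse? m p ∘ map toℕ) (allFin n)
         (λ {M} τ (matching , l) → matching⇒sparse τ matching , trans (List.length-map toℕ M) l)
         (λ {M} τ ((s , w) , l) → sparse⇒matching τ s w , trans (sym (List.length-map toℕ M)) l) ⟩
  count (cyclicallySparse? m p ∘ map toℕ) (allFin n)
    ≡⟨ count-map (cyclicallySparse? m p) toℕ (allFin n) ⟨
  count (cyclicallySparse? m p) (map toℕ (allFin n))
    ≡⟨ cong (count (cyclicallySparse? m p)) (map-toℕ-allFin n) ⟩
  count (cyclicallySparse? m p) (interval 0 n)
    ≡⟨ count-cyclicallySparse m p ⟩
  cycleCount m p
    ∎
  where
  n = 2 ℕ.+ m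
  open Multigraph (cycle n) using (isMatching?)
  open ≡-Reasoning

-- Integer sums over lists

sumℤ-++ : ∀ xs ys → sumℤ (xs ++ ys) ≡ sumℤ xs ℤ.+ sumℤ ys
sumℤ-++ []       ys = sym (ℤ.+-identityˡ (sumℤ ys))
sumℤ-++ (x ∷ xs) ys =
  trans (cong (λ s → x ℤ.+ s) (sumℤ-++ xs ys)) (sym (ℤ.+-assoc x (sumℤ xs) (sumℤ ys)))

sumℤ-map-+ : (f g : A → ℤ) (xs : List A) →
  sumℤ (map (λ x → f x ℤ.+ g x) xs) ≡ sumℤ (map f xs) ℤ.+ sumℤ (map g xs)
sumℤ-map-+ f g [] = refl
sumℤ-map-+ f g (x ∷ xs) =
  trans (cong (λ s → f x ℤ.+ g x ℤ.+ s) (sumℤ-map-+ f g xs))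
        (interchange (f x) (g x) (sumℤ (map f xs)) (sumℤ (map g xs)))
  where
  open import Algebra.Properties.CommutativeSemigroup ℤ.+-commutativeSemigroup using (interchange)

sumℤ-concatMap : (f : B → ℤ) (g : A → List B) (xs : List A) →
  sumℤ (map f (concatMap g xs)) ≡ sumℤ (map (λ x → sumℤ (map f (g x))) xs)
sumℤ-concatMap f g [] = refl
sumℤ-concatMap f g (x ∷ xs) = begin
  sumℤ (map f (g x ++ concatMap g xs))
    ≡⟨ cong sumℤ (List.map-++ f (g x) (concatMap g xs)) ⟩
  sumℤ (map f (g x) ++ map f (concatMap g xs))
    ≡⟨ sumℤ-++ (map f (g x)) (map f (concatMap g xs)) ⟩
  sumℤ (map f (g x)) ℤ.+ sumℤ (map f (concatMap g xs))
    ≡⟨ cong (λ s → sumℤ (map f (g x)) ℤ.+ s) (sumℤ-concatMap f g xs) ⟩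
  sumℤ (map (λ x → sumℤ (map f (g x))) (x ∷ xs))
    ∎
  where open ≡-Reasoning

sumℤ-1 : (xs : List A) → sumℤ (map (λ _ → 1ℤ) xs) ≡ + length xs
sumℤ-1 []       = refl
sumℤ-1 (_ ∷ xs) = cong (λ s → 1ℤ ℤ.+ s) (sumℤ-1 xs)

-- Replacing the discarded entries by zeros keeps the index set intact, so that sums over selected
-- edges can be regrouped by columns.
mask : {P : Pred A 0ℓ} → Decidable P → (A → ℤ) → A → ℤ
mask P? f x = if does (P? x) then f x else 0ℤ

module _ {P : Pred A 0ℓ} (P? : Decidable P) {f : A → ℤ} where

  mask-yes : ∀ {x} → P x → mask P? f x ≡ f x
  mask-yes {x} p with P? x
  ... | yes _ = refl
  ... | no ¬p = contradiction p ¬p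

  mask-no : ∀ {x} → ¬ P x → mask P? f x ≡ 0ℤ
  mask-no {x} ¬p with P? x
  ... | yes p = contradiction p ¬p
  ... | no _  = refl

  mask-zero : ∀ {x} → f x ≡ 0ℤ → mask P? f x ≡ 0ℤ
  mask-zero {x} fx≡0 with P? x
  ... | yes _ = fx≡0
  ... | no _  = refl

  sumℤ-filter : ∀ xs → sumℤ (map f (filter P? xs)) ≡ sumℤ (map (mask P? f) xs)
  sumℤ-filter [] = refl
  sumℤ-filter (x ∷ xs) with P? x
  ... | yes _ = cong (λ s → f x ℤ.+ s) (sumℤ-filter xs)
  ... | no _  = trans (sumℤ-filter xs) (sym (ℤ.+-identityˡ _))

sumℤ-allFin : ∀ n (f : Fin n → ℤ) → sumℤ (map f (allFin n)) ≡ sumℤ (tabulate f)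
sumℤ-allFin n f = cong sumℤ (List.map-tabulate id f)

sumℤ-tabulate-last : ∀ k (f : Fin (suc k) → ℤ) → (∀ j → suc (toℕ j) ≢ suc k → f j ≡ 0ℤ) →
                     sumℤ (tabulate f) ≡ f (fromℕ k)
sumℤ-tabulate-last zero    f f≡0 = ℤ.+-identityʳ (f zero)
sumℤ-tabulate-last (suc k) f f≡0 =
  trans (cong₂ ℤ._+_ (f≡0 zero λ ())
                     (sumℤ-tabulate-last k (f ∘ suc) λ j j≢ → f≡0 (suc j) (j≢ ∘ ℕ.suc-injective)))
        (ℤ.+-identityˡ _)

-- With the length written as `m * 2`, each induction step exposes exactly two entries, an even
-- index and its successor.
sumℤ-tabulate-pairs : ∀ m (f : Fin (m ℕ.* 2) → ℤ) →
  (∀ i j → 2 ∣ toℕ i → toℕ j ≡ suc (toℕ i) → f i ℤ.+ f j ≡ 1ℤ) →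
  sumℤ (tabulate f) ≡ + m
sumℤ-tabulate-pairs zero    f pair = refl
sumℤ-tabulate-pairs (suc m) f pair = begin
  f zero ℤ.+ (f (suc zero) ℤ.+ s)  ≡⟨ ℤ.+-assoc (f zero) (f (suc zero)) s ⟨
  f zero ℤ.+ f (suc zero) ℤ.+ s    ≡⟨ cong₂ ℤ._+_ (pair zero (suc zero) (divides 0 refl) refl) ih ⟩
  + suc m                          ∎
  where
  open ≡-Reasoning
  f′ : Fin (m ℕ.* 2) → ℤ
  f′ i = f (suc (suc i))
  s = sumℤ (tabulate f′)
  ih : s ≡ + m
  ih = sumℤ-tabulate-pairs m f′ λ i j 2∣i j≡1+i →
    pair (suc (suc i)) (suc (suc j)) (∣m∣n⇒∣m+n ∣-refl 2∣i) (cong (λ i → suc (suc i)) j≡1+i)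

-- Parity and colours

2∣n⊎2∣1+n : ∀ n → 2 ∣ n ⊎ 2 ∣ suc n
2∣n⊎2∣1+n zero = inj₁ (divides 0 refl)
2∣n⊎2∣1+n (suc n) with 2∣n⊎2∣1+n n
... | inj₁ 2∣n   = inj₂ (∣m∣n⇒∣m+n ∣-refl 2∣n)
... | inj₂ 2∣1+n = inj₁ 2∣1+n

2∣n⇒2∤1+n : ∀ {n} → 2 ∣ n → ¬ 2 ∣ suc n
2∣n⇒2∤1+n {n} 2∣n 2∣1+n
  with () ← ∣1⇒≡1 (∣m+n∣m⇒∣n (subst (2 ∣_) (ℕ.+-comm 1 n) 2∣1+n) 2∣n)

-- The coordinate sums in a column are `j` and `suc j`, one of which is even. The black node is
-- where the remaining vertical edge of the column starts.
blackRow : ∀ {n} (j : Fin n) → ∃ λ r → Black (r , j)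
blackRow j with 2∣n⊎2∣1+n (toℕ j)
... | inj₁ 2∣j   = zero , 2∣j
... | inj₂ 2∣1+j = suc zero , 2∣1+j

blackRow-unique : ∀ {n} {j : Fin n} {r s} → Black (r , j) → Black (s , j) → r ≡ s
blackRow-unique {r = zero}     {zero}     _ _ = refl
blackRow-unique {r = zero}     {suc zero} p q = contradiction q (2∣n⇒2∤1+n p)
blackRow-unique {r = suc zero} {zero}     p q = contradiction p (2∣n⇒2∤1+n q)
blackRow-unique {r = suc zero} {suc zero} _ _ = refl

orientation-black : ∀ {n} {x : StripNode n} → Black x → orientation x ≡ 1ℤ
orientation-black {x = x} b with black? x
... | yes _ = refl
... | no ¬b = contradiction b ¬b

orientation-white : ∀ {n} {x : StripNode n} → ¬ Black x → orientation x ≡ -1ℤ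
orientation-white {x = x} ¬b with black? x
... | yes b = contradiction b ¬b
... | no _  = refl

-- The strip of hexagons

_≟ᵉ_ : ∀ {n} → DecidableEquality (StripEdge n)
h r i ≟ᵉ h s j = map′ (λ { (refl , refl) → refl }) (λ { refl → refl , refl }) ((r Fin.≟ s) ×-dec (i Fin.≟ j))
v r i ≟ᵉ v s j = map′ (λ { (refl , refl) → refl }) (λ { refl → refl , refl }) ((r Fin.≟ s) ×-dec (i Fin.≟ j))
h _ _ ≟ᵉ v _ _ = no λ ()
v _ _ ≟ᵉ h _ _ = no λ ()

columnEdges : ∀ {n} → Fin n → List (StripEdge n)
columnEdges j = h zero j ∷ h (suc zero) j ∷ v zero j ∷ v (suc zero) j ∷ []

columnOf : ∀ {n} → StripEdge n → Fin n
columnOf (h _ j) = j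
columnOf (v _ j) = j

∈-columnEdges⁺ : ∀ {n} (e : StripEdge n) → e ∈ columnEdges (columnOf e)
∈-columnEdges⁺ (h zero j)       = here refl
∈-columnEdges⁺ (h (suc zero) j) = there (here refl)
∈-columnEdges⁺ (v zero j)       = there (there (here refl))
∈-columnEdges⁺ (v (suc zero) j) = there (there (there (here refl)))

∈-columnEdges⁻ : ∀ {n} {e : StripEdge n} j → e ∈ columnEdges j → columnOf e ≡ j
∈-columnEdges⁻ j e∈ = All.lookup {P = λ e → columnOf e ≡ j} (refl ∷ refl ∷ refl ∷ refl ∷ []) e∈

∈-squareEdges : ∀ {n} (e : StripEdge n) → e ∈ squareEdges n
∈-squareEdges e = ∈-concatMap⁺ columnEdges (lose (∈-allFin (columnOf e)) (∈-columnEdges⁺ e))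

squareEdges-unique : ∀ n → Unique (squareEdges n)
squareEdges-unique n = Unique.concat⁺
  (All.map⁺ (All.tabulate λ _ →
    ((λ ()) ∷ (λ ()) ∷ (λ ()) ∷ []) ∷ ((λ ()) ∷ (λ ()) ∷ []) ∷ ((λ ()) ∷ []) ∷ [] ∷ []))
  (AllPairs.map⁺ (AllPairs.map disjoint (Unique.allFin⁺ n)))
  where
  disjoint : ∀ {i j : Fin n} → i ≢ j → Disjoint (columnEdges i) (columnEdges j)
  disjoint i≢j (e∈i , e∈j) = i≢j (trans (sym (∈-columnEdges⁻ _ e∈i)) (∈-columnEdges⁻ _ e∈j))

∈-hexagonEdges⁺ : ∀ {n} {e : StripEdge n} → Hexagonal e → e ∈ hexagonEdges n
∈-hexagonEdges⁺ {e = e} hex = ∈-filter⁺ hexagonal? (∈-squareEdges e) hex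

∈-hexagonEdges⁻ : ∀ {n} {e : StripEdge n} → e ∈ hexagonEdges n → Hexagonal e
∈-hexagonEdges⁻ {n} e∈ = proj₂ (∈-filter⁻ hexagonal? {xs = squareEdges n} e∈)

hexagonEdges-unique : ∀ n → Unique (hexagonEdges n)
hexagonEdges-unique n = Unique.filter⁺ hexagonal? (squareEdges-unique n)

∈-stripNodes : ∀ {n} E (x : StripNode n) → x ∈ Multigraph.nodes (strip n E)
∈-stripNodes E (r , j) = ∈-concatMap⁺ (λ j → (zero , j) ∷ (suc zero , j) ∷ [])
                                      (lose (∈-allFin j) (row r))
  where
  row : ∀ r → (r , j) ∈ (zero , j) ∷ (suc zero , j) ∷ []
  row zero       = here refl
  row (suc zero) = there (here refl)

-- The induction starts at the last column because the edges across `w` leave from there; one step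
-- of `next` leads to column `0`, and the others go upwards.
next-induction : ∀ {k} (P : Fin (suc k) → Set) → P (fromℕ k) → (∀ j → P j → P (next j)) →
                 ∀ j → P j
next-induction {k} P base step j = go (toℕ j) j refl
  where
  go : ∀ i j → toℕ j ≡ i → P j
  go zero j j≡0 with toℕ-next (fromℕ k)
  ... | inj₁ p = contradiction (trans p (cong suc (Fin.toℕ-fromℕ k)))
                               (ℕ.<⇒≢ (Fin.toℕ<n (next (fromℕ k))))
  ... | inj₂ (_ , p) = subst P (Fin.toℕ-injective (trans p (sym j≡0))) (step _ base)
  go (suc i) j j≡1+i = subst P next≡j (step (fromℕ< i<n) (go i _ (Fin.toℕ-fromℕ< i<n)))
    where
    1+i<n : suc i ℕ.< suc k
    1+i<n = subst (ℕ._< suc k) j≡1+i (Fin.toℕ<n j)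
    i<n : i ℕ.< suc k
    i<n = ℕ.<⇒≤ 1+i<n
    next≡j : next (fromℕ< i<n) ≡ j
    next≡j with toℕ-next (fromℕ< i<n)
    ... | inj₁ p = Fin.toℕ-injective (trans p (trans (cong suc (Fin.toℕ-fromℕ< i<n)) (sym j≡1+i)))
    ... | inj₂ (p , _) = contradiction (trans (cong suc (sym (Fin.toℕ-fromℕ< i<n))) p) (ℕ.<⇒≢ 1+i<n)

-- Weights of selected hexagon edges

hexagonSum : ∀ {n} {P : Pred (StripEdge n) 0ℓ} (P? : Decidable P) (f : StripEdge n → ℤ) →
  sumℤ (map f (filter P? (hexagonEdges n))) ≡
  sumℤ (tabulate λ j → sumℤ (map (mask hexagonal? (mask P? f)) (columnEdges j)))
hexagonSum {n} P? f = begin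
  sumℤ (map f (filter P? (hexagonEdges n)))
    ≡⟨ sumℤ-filter P? (hexagonEdges n) ⟩
  sumℤ (map (mask P? f) (hexagonEdges n))
    ≡⟨ sumℤ-filter hexagonal? (squareEdges n) ⟩
  sumℤ (map (mask hexagonal? (mask P? f)) (squareEdges n))
    ≡⟨ sumℤ-concatMap (mask hexagonal? (mask P? f)) columnEdges (allFin n) ⟩
  sumℤ (map (λ j → sumℤ (map (mask hexagonal? (mask P? f)) (columnEdges j))) (allFin n))
    ≡⟨ sumℤ-allFin n _ ⟩
  sumℤ (tabulate λ j → sumℤ (map (mask hexagonal? (mask P? f)) (columnEdges j)))
    ∎
  where open ≡-Reasoning

sumℤ-columnEdges : ∀ {n} (f : StripEdge n → ℤ) (j : Fin n) {w x y z : ℤ} →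
  f (h zero j) ≡ w → f (h (suc zero) j) ≡ x → f (v zero j) ≡ y → f (v (suc zero) j) ≡ z →
  sumℤ (map f (columnEdges j)) ≡ sumℤ (w ∷ x ∷ y ∷ z ∷ [])
sumℤ-columnEdges f j refl refl refl refl = refl

zWeight-select : ∀ {n} {P : Pred (StripEdge n) 0ℓ} (P? : Decidable P) →
  zWeight (filter P? (hexagonEdges n)) ≡
  sumℤ (tabulate λ j → mask hexagonal? (mask P? zWeightOf) (v (suc zero) j))
zWeight-select P? = trans (hexagonSum P? zWeightOf) (cong sumℤ (List.tabulate-cong λ j →
  trans (sumℤ-columnEdges (mask hexagonal? (mask P? zWeightOf)) j
              (mask-zero P? {zWeightOf} {h zero j} refl)
              (mask-zero P? {zWeightOf} {h (suc zero) j} refl)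
              (mask-zero hexagonal? {mask P? zWeightOf} {v zero j} (mask-zero P? {zWeightOf} {v zero j} refl))
              refl)
    (trans (ℤ.+-identityˡ _) (trans (ℤ.+-identityˡ _) (trans (ℤ.+-identityˡ _) (ℤ.+-identityʳ _))))))

-- Only horizontal edges of the last column cross `w`. Its index is odd because the number of
-- columns is even, so its bottom node is white and its top node black.
wWeight-select : ∀ {k} {P : Pred (StripEdge (suc k)) 0ℓ} → 2 ∣ suc k → (P? : Decidable P) →
  wWeight (filter P? (hexagonEdges (suc k))) ≡
  (if does (P? (h zero (fromℕ k))) then -1ℤ else 0ℤ) ℤ.+
  (if does (P? (h (suc zero) (fromℕ k))) then 1ℤ else 0ℤ)
wWeight-select {k} 2∣n P? = begin
  wWeight (filter P? (hexagonEdges (suc k)))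
    ≡⟨ hexagonSum P? wWeightOf ⟩
  sumℤ (tabulate λ j → sumℤ (map (mask hexagonal? (mask P? wWeightOf)) (columnEdges j)))
    ≡⟨ sumℤ-tabulate-last k _ (λ j j≢ → sumℤ-columnEdges (mask hexagonal? (mask P? wWeightOf)) j
         (mask-zero P? {wWeightOf} {h zero j} (elsewhere zero j j≢))
         (mask-zero P? {wWeightOf} {h (suc zero) j} (elsewhere (suc zero) j j≢))
         (vertical zero j) (vertical (suc zero) j)) ⟩
  sumℤ (map (mask hexagonal? (mask P? wWeightOf)) (columnEdges ℓ))
    ≡⟨ sumℤ-columnEdges (mask hexagonal? (mask P? wWeightOf)) ℓ
            (cong (λ w → if does (P? (h zero ℓ)) then w else 0ℤ) bottom)
            (cong (λ w → if does (P? (h (suc zero) ℓ)) then w else 0ℤ) top)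
            (vertical zero ℓ) (vertical (suc zero) ℓ) ⟩
  _
    ≡⟨ cong (λ s → (if does (P? (h zero ℓ)) then -1ℤ else 0ℤ) ℤ.+ s) (ℤ.+-identityʳ _) ⟩
  _
    ∎
  where
  open ≡-Reasoning
  ℓ = fromℕ k
  vertical : ∀ r j → mask hexagonal? (mask P? wWeightOf) (v r j) ≡ 0ℤ
  vertical r j = mask-zero hexagonal? {mask P? wWeightOf} {v r j} (mask-zero P? {wWeightOf} {v r j} refl)
  elsewhere : ∀ r (j : Fin (suc k)) → suc (toℕ j) ≢ suc k → wWeightOf (h r j) ≡ 0ℤ
  elsewhere r j j≢ with suc (toℕ j) ℕ.≟ suc k
  ... | yes j≡ = contradiction j≡ j≢
  ... | no _   = refl
  crossing : ∀ r → wWeightOf (h r ℓ) ≡ orientation (r , ℓ)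
  crossing r with suc (toℕ ℓ) ℕ.≟ suc k
  ... | yes _ = refl
  ... | no ℓ≢ = contradiction (cong suc (Fin.toℕ-fromℕ k)) ℓ≢
  topBlack : Black (suc zero , ℓ)
  topBlack = subst (λ i → 2 ∣ suc i) (sym (Fin.toℕ-fromℕ k)) 2∣n
  bottom : wWeightOf (h zero ℓ) ≡ -1ℤ
  bottom = trans (crossing zero) (orientation-white λ b → 2∣n⇒2∤1+n b topBlack)
  top : wWeightOf (h (suc zero) ℓ) ≡ 1ℤ
  top = trans (crossing (suc zero)) (orientation-black topBlack)

private
  module Cycle {n} = Multigraph (cycle n)
  module Hex {n} = Multigraph (stripOfHexagons n)

touches-h⁻ : ∀ {n r s} {i j : Fin n} → Hex.Touches (r , j) (h s i) → s ≡ r × Cycle.Touches j i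
touches-h⁻ (inj₁ refl) = refl , inj₁ refl
touches-h⁻ (inj₂ refl) = refl , inj₂ refl

touches-h⁺ : ∀ {n r} {i j : Fin n} → Cycle.Touches j i → Hex.Touches (r , j) (h r i)
touches-h⁺ (inj₁ refl) = inj₁ refl
touches-h⁺ (inj₂ refl) = inj₂ refl

touches-v⁻ : ∀ {n r s} {i j : Fin n} → Hex.Touches (r , j) (v s i) → i ≡ j
touches-v⁻ (inj₁ refl) = refl
touches-v⁻ (inj₂ refl) = refl

touches-v⁺ : ∀ {n} r s (j : Fin n) → Hex.Touches (r , j) (v s j)
touches-v⁺ zero       zero       j = inj₁ refl
touches-v⁺ zero       (suc zero) j = inj₂ refl
touches-v⁺ (suc zero) zero       j = inj₂ refl
touches-v⁺ (suc zero) (suc zero) j = inj₁ refl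

-- Matchings of the cycle and perfect matchings of the strip

Covered : ∀ {n} → List (Fin n) → Fin n → Set
Covered M j = Any (Cycle.Touches j) M

-- The clause for `v r j` may ignore the row: `lift` selects among hexagon edges, and there only the
-- row of the black node is left.
Lifted : ∀ {n} → List (Fin n) → StripEdge n → Set
Lifted M (h r j) = j ∈ M
Lifted M (v r j) = ¬ Covered M j

lifted? : ∀ {n} (M : List (Fin n)) → Decidable (Lifted M)
lifted? M (h r j) = _∈?_ Fin._≟_ j M
lifted? M (v r j) = ¬? (any? (Cycle.touches? j) M)

lift : ∀ {n} → List (Fin n) → List (StripEdge n)
lift {n} M = filter (lifted? M) (hexagonEdges n)

-- Reading the bottom row is enough, since at w-weight zero a perfect matching has the same
-- horizontal edges in the top row.
project : ∀ {n} → List (StripEdge n) → List (Fin n)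
project {n} K = filter (λ j → _∈?_ _≟ᵉ_ (h zero j) K) (allFin n)

∈-lift⁺ : ∀ {n} {M : List (Fin n)} {e} → Hexagonal e → Lifted M e → e ∈ lift M
∈-lift⁺ {M = M} hex l = ∈-filter⁺ (lifted? M) (∈-hexagonEdges⁺ hex) l

∈-lift⁻ : ∀ {n} {M : List (Fin n)} {e} → e ∈ lift M → Hexagonal e × Lifted M e
∈-lift⁻ {n} {M} e∈ =
  let e∈E , l = ∈-filter⁻ (lifted? M) {xs = hexagonEdges n} e∈ in ∈-hexagonEdges⁻ e∈E , l

∈-project⁺ : ∀ {n} {K : List (StripEdge n)} {j} → h zero j ∈ K → j ∈ project K
∈-project⁺ {K = K} {j} hj∈ = ∈-filter⁺ (λ j → _∈?_ _≟ᵉ_ (h zero j) K) (∈-allFin j) hj∈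

∈-project⁻ : ∀ {n} {K : List (StripEdge n)} {j} → j ∈ project K → h zero j ∈ K
∈-project⁻ {n} {K} j∈ = proj₂ (∈-filter⁻ (λ j → _∈?_ _≟ᵉ_ (h zero j) K) {xs = allFin n} j∈)

lift-⊆ : ∀ {n} (M : List (Fin n)) → lift M ⊆ hexagonEdges n
lift-⊆ {n} M = filter-⊆ (lifted? M) (hexagonEdges n)

project-⊆ : ∀ {n} (K : List (StripEdge n)) → project K ⊆ allFin n
project-⊆ {n} K = filter-⊆ (λ j → _∈?_ _≟ᵉ_ (h zero j) K) (allFin n)

project-lift : ∀ {n} {M : List (Fin n)} → M ⊆ allFin n → project (lift M) ≡ M
project-lift {n} {M} τ = ⊆-extensional (Unique.allFin⁺ n) (project-⊆ (lift M)) τ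
  (λ j∈ → proj₂ (∈-lift⁻ {M = M} (∈-project⁻ j∈)))
  (λ j∈ → ∈-project⁺ (∈-lift⁺ {M = M} _ j∈))

module _ {n} {M : List (Fin n)} (matching : Cycle.IsMatching M) where

  matching⇒atMostOne : ∀ x → AtMostOne (cycle n) M x
  matching⇒atMostOne x = degree≤1⁻ (cycle n) (All.lookup matching (∈-allFin x))

  -- In a covered column the covering edge is present in both rows and the vertical edge is absent.
  -- In an uncovered column the vertical edge alone touches both nodes.
  lift-perfect : Hex.IsPerfectMatching (lift M)
  lift-perfect = All.tabulate λ {x} _ → degree≡1 x
    where
    one : ∀ r j → AtMostOne (stripOfHexagons n) (lift M) (r , j)
    one r j {h _ i} {h _ i′} e∈ f∈ te tf with touches-h⁻ te | touches-h⁻ tf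
    ... | refl , ti | refl , ti′ = cong (h r)
      (matching⇒atMostOne j (proj₂ (∈-lift⁻ {M = M} e∈)) (proj₂ (∈-lift⁻ {M = M} f∈)) ti ti′)
    one r j {h _ i} {v _ _} e∈ f∈ te tf with touches-h⁻ te | touches-v⁻ tf
    ... | _ , ti | refl =
      contradiction (lose (proj₂ (∈-lift⁻ {M = M} e∈)) ti) (proj₂ (∈-lift⁻ {M = M} f∈))
    one r j {v _ _} {h _ i} e∈ f∈ te tf with touches-v⁻ te | touches-h⁻ tf
    ... | refl | _ , ti =
      contradiction (lose (proj₂ (∈-lift⁻ {M = M} f∈)) ti) (proj₂ (∈-lift⁻ {M = M} e∈))
    one r j {v s _} {v s′ _} e∈ f∈ te tf with touches-v⁻ te | touches-v⁻ tf
    ... | refl | refl = cong (λ s → v s j)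
      (blackRow-unique (proj₁ (∈-lift⁻ {M = M} e∈)) (proj₁ (∈-lift⁻ {M = M} f∈)))
    lift! : Unique (lift M)
    lift! = Unique.filter⁺ (lifted? M) (hexagonEdges-unique n)
    degree≡1 : ∀ x → Hex.degree (lift M) x ≡ 1
    degree≡1 (r , j) with any? (Cycle.touches? j) M
    ... | yes covered with find covered
    ...   | i , i∈ , ti =
      degree≡1⁺ (stripOfHexagons n) lift! (one r j) (∈-lift⁺ {M = M} {e = h r i} _ i∈) (touches-h⁺ ti)
    degree≡1 (r , j) | no uncovered with blackRow j
    ... | s , b =
      degree≡1⁺ (stripOfHexagons n) lift! (one r j) (∈-lift⁺ {M = M} {e = v s j} b uncovered) (touches-v⁺ r s j)

module _ {k} (2∣n : 2 ∣ suc k) where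
  private n = suc k

  lift-wWeight : (M : List (Fin n)) → wWeight (lift M) ≡ 0ℤ
  lift-wWeight M with wWeight-select 2∣n (lifted? M)
  -- Selection does not depend on the row, so the weight is `-1 + 1` or `0 + 0`.
  ... | eq with _∈?_ Fin._≟_ (fromℕ k) M
  ...   | yes _ = eq
  ...   | no _  = eq

  module _ (2≤n : 2 ℕ.≤ n) {K : List (StripEdge n)} (τ : K ⊆ hexagonEdges n)
           (perfect : Hex.IsPerfectMatching K) where

    private
      perfect⇒atMostOne : ∀ x → AtMostOne (stripOfHexagons n) K x
      perfect⇒atMostOne x = degree≤1⁻ (stripOfHexagons n)
        (ℕ.≤-reflexive (All.lookup perfect (∈-stripNodes (hexagonEdges n) x)))

      perfect⇒atLeastOne : ∀ x → ∃ λ e → e ∈ K × Hex.Touches x e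
      perfect⇒atLeastOne x =
        degree≡1⁻ (stripOfHexagons n) (All.lookup perfect (∈-stripNodes (hexagonEdges n) x))

      SameRows : Fin n → Set
      SameRows j = ∀ r s → h r j ∈ K → h s j ∈ K

    project-matching : Cycle.IsMatching (project K)
    project-matching = All.tabulate λ {x} _ → degree≤1⁺ (cycle n)
      (AllPairs-resp-⊆ (project-⊆ K) (Unique.allFin⁺ n))
      λ i∈ j∈ ti tj → h-injective
        (perfect⇒atMostOne (zero , x) (∈-project⁻ i∈) (∈-project⁻ j∈) (touches-h⁺ ti) (touches-h⁺ tj))
      where
      h-injective : ∀ {r s} {i j : Fin n} → h r i ≡ h s j → i ≡ j
      h-injective refl = refl

    -- Consider the edge of `K` at the other node of column `next j`. A vertical edge would also
    -- touch `(r , next j)`, already used by `h r (next j)`. A horizontal edge arriving from column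
    -- `j` would, by `same`, have a copy in row `r` that arrives at `(r , next j)` too. Hence the
    -- edge leaves to the right, as claimed.
    sameRows-next : ∀ j → SameRows j → SameRows (next j)
    sameRows-next j same r s hr∈ with perfect⇒atLeastOne (s , next j)
    ... | v s′ _ , v∈ , tv with touches-v⁻ tv
    ...   | refl with () ← perfect⇒atMostOne (r , next j) hr∈ v∈ (inj₁ refl) (touches-v⁺ r s′ (next j))
    sameRows-next j same r s hr∈ | h _ i , h∈ , th with touches-h⁻ th
    ... | refl , inj₁ refl = h∈
    ... | refl , inj₂ ni≡nj with next-injective ni≡nj
    ...   | refl with perfect⇒atMostOne (r , next j) hr∈ (same s r h∈) (inj₁ refl) (inj₂ refl)
    ...     | eq = contradiction (cong columnOf eq) (next≢ 2≤n j)

    -- The weight formulas are about selections by a predicate; membership in `K` is such a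
    -- predicate.
    self-select : K ≡ filter (λ e → _∈?_ _≟ᵉ_ e K) (hexagonEdges n)
    self-select = ⊆-extensional (hexagonEdges-unique n) τ
      (filter-⊆ (λ e → _∈?_ _≟ᵉ_ e K) (hexagonEdges n))
      (λ e∈ → ∈-filter⁺ (λ e → _∈?_ _≟ᵉ_ e K) (Any-resp-⊆ τ e∈) e∈)
      (λ e∈ → proj₂ (∈-filter⁻ (λ e → _∈?_ _≟ᵉ_ e K) {xs = hexagonEdges n} e∈))

    module _ (w≡0 : wWeight K ≡ 0ℤ) where

      -- The two edges across w have opposite w-weights.
      sameRows-last : SameRows (fromℕ k)
      sameRows-last r s hr∈
        with trans (sym (wWeight-select 2∣n (λ e → _∈?_ _≟ᵉ_ e K))) (trans (cong wWeight (sym self-select)) w≡0)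
      ... | eq with _∈?_ _≟ᵉ_ (h zero (fromℕ k)) K | _∈?_ _≟ᵉ_ (h (suc zero) (fromℕ k)) K
      sameRows-last r          zero       _   | _ | yes 0∈ | yes 1∈ = 0∈
      sameRows-last r          (suc zero) _   | _ | yes 0∈ | yes 1∈ = 1∈
      sameRows-last zero       s          hr∈ | _ | no 0∉  | no 1∉  = contradiction hr∈ 0∉
      sameRows-last (suc zero) s          hr∈ | _ | no 0∉  | no 1∉  = contradiction hr∈ 1∉

      sameRows : ∀ j → SameRows j
      sameRows = next-induction SameRows sameRows-last sameRows-next

      lift-project : lift (project K) ≡ K
      lift-project = ⊆-extensional (hexagonEdges-unique n) (lift-⊆ (project K)) τ to from
        where
        to : ∀ {e} → e ∈ lift (project K) → e ∈ K
        to {h r j} e∈ = sameRows j zero r (∈-project⁻ (proj₂ (∈-lift⁻ {M = project K} e∈)))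
        -- Column `j` is uncovered, so the edge of `K` at its bottom node cannot be horizontal. It
        -- is vertical, and the column has only one black node from which it can start.
        to {v r j} e∈ with ∈-lift⁻ {M = project K} e∈ | perfect⇒atLeastOne (zero , j)
        ... | b , uncovered | h s i , h∈ , th with touches-h⁻ th
        ...   | refl , ti = contradiction (lose (∈-project⁺ h∈) ti) uncovered
        to {v r j} e∈ | b , uncovered | v s i , v∈ , tv with touches-v⁻ tv
        ...   | refl = subst (λ t → v t j ∈ K)
                         (blackRow-unique (∈-hexagonEdges⁻ (Any-resp-⊆ τ v∈)) b) v∈
        from : ∀ {e} → e ∈ K → e ∈ lift (project K)
        from {h r j} e∈ = ∈-lift⁺ {M = project K} _ (∈-project⁺ (sameRows j r zero e∈))
        from {v r j} e∈ = ∈-lift⁺ {M = project K} (∈-hexagonEdges⁻ (Any-resp-⊆ τ e∈)) uncovered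
          where
          uncovered : ¬ Covered (project K) j
          uncovered c with find c
          ... | i , i∈ , ti with () ← perfect⇒atMostOne (zero , j) (∈-project⁻ i∈) e∈ (touches-h⁺ ti) (touches-v⁺ zero r j)

-- The z-weight of a lifted matching

length-as-sum : ∀ {n} {M : List (Fin n)} → M ⊆ allFin n →
  + length M ≡ sumℤ (tabulate (mask (λ j → _∈?_ Fin._≟_ j M) (λ _ → 1ℤ)))
length-as-sum {n} {M} τ = begin
  + length M
    ≡⟨ cong (+_ ∘ length) M≡filter ⟩
  + length (filter M? (allFin n))
    ≡⟨ sumℤ-1 (filter M? (allFin n)) ⟨
  sumℤ (map (λ _ → 1ℤ) (filter M? (allFin n)))
    ≡⟨ sumℤ-filter M? (allFin n) ⟩
  sumℤ (map (mask M? (λ _ → 1ℤ)) (allFin n))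
    ≡⟨ sumℤ-allFin n _ ⟩
  sumℤ (tabulate (mask M? (λ _ → 1ℤ)))
    ∎
  where
  open ≡-Reasoning
  M? : Decidable (_∈ M)
  M? j = _∈?_ Fin._≟_ j M
  M≡filter : M ≡ filter M? (allFin n)
  M≡filter = ⊆-extensional (Unique.allFin⁺ n) τ (filter-⊆ M? (allFin n))
    (λ {j} j∈ → ∈-filter⁺ M? (∈-allFin j) j∈)
    (λ j∈ → proj₂ (∈-filter⁻ M? {xs = allFin n} j∈))

module _ (m : ℕ) {M : List (Fin (m ℕ.* 2))} (τ : M ⊆ allFin (m ℕ.* 2))
         (matching : Cycle.IsMatching M) (2≤n : 2 ℕ.≤ m ℕ.* 2) where
  private
    n = m ℕ.* 2

    M? : Decidable (_∈ M)
    M? j = _∈?_ Fin._≟_ j M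

    upward edges : Fin n → ℤ
    upward j = mask hexagonal? (mask (lifted? M) zWeightOf) (v (suc zero) j)
    edges = mask M? (λ _ → 1ℤ)

    one : ∀ x → AtMostOne (cycle n) M x
    one = matching⇒atMostOne matching

  module _ (i j : Fin n) (2∣i : 2 ∣ toℕ i) (j≡1+i : toℕ j ≡ suc (toℕ i)) where
    private
      next-i : next i ≡ j
      next-i with toℕ-next i
      ... | inj₁ p       = Fin.toℕ-injective (trans p (sym j≡1+i))
      ... | inj₂ (p , _) = contradiction (trans j≡1+i p) (ℕ.<⇒≢ (Fin.toℕ<n j))

      i≢j : i ≢ j
      i≢j i≡j = ℕ.1+n≢n (trans (sym j≡1+i) (sym (cong toℕ i≡j)))

      topBlack : Black (suc zero , j)
      topBlack = subst (λ k → 2 ∣ suc k) (sym j≡1+i) (∣m∣n⇒∣m+n ∣-refl 2∣i)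

      upward-i : upward i ≡ 0ℤ
      upward-i = mask-no hexagonal? {mask (lifted? M) zWeightOf} {v (suc zero) i} (2∣n⇒2∤1+n 2∣i)

      upward-j : upward j ≡ mask (lifted? M) zWeightOf (v (suc zero) j)
      upward-j = mask-yes hexagonal? {mask (lifted? M) zWeightOf} {v (suc zero) j} topBlack

      covered : Covered M j → upward j ≡ 0ℤ
      covered c = trans upward-j (mask-no (lifted? M) {zWeightOf} {v (suc zero) j} (λ ¬c → ¬c c))

      uncovered : ¬ Covered M j → upward j ≡ 1ℤ
      uncovered ¬c = trans upward-j
        (trans (mask-yes (lifted? M) {zWeightOf} {v (suc zero) j} ¬c) (orientation-black topBlack))

    -- In the even column `i` the top node is white, so no edge crosses `z`; in the odd column `j`
    -- the remaining vertical edge crosses it with weight 1. The cycle edges at node `j` are exactly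
    -- `i` and `j`, so one of them lies in `M`, or else `j` is uncovered and its vertical edge is
    -- selected; these three cases exclude each other.
    oneEdgePerPair : (upward i ℤ.+ edges i) ℤ.+ (upward j ℤ.+ edges j) ≡ 1ℤ
    oneEdgePerPair = trans (cong (λ s → (s ℤ.+ edges i) ℤ.+ (upward j ℤ.+ edges j)) upward-i) rest
      where
      rest : (0ℤ ℤ.+ edges i) ℤ.+ (upward j ℤ.+ edges j) ≡ 1ℤ
      rest with M? i | M? j
      ... | yes i∈ | yes j∈ = contradiction (one j i∈ j∈ (inj₂ next-i) (inj₁ refl)) i≢j
      ... | yes i∈ | no _   = cong (λ s → 1ℤ ℤ.+ (s ℤ.+ 0ℤ)) (covered (lose i∈ (inj₂ next-i)))
      ... | no _   | yes j∈ = cong (λ s → 0ℤ ℤ.+ (s ℤ.+ 1ℤ)) (covered (lose j∈ (inj₁ refl)))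
      ... | no i∉  | no j∉  = cong (λ s → 0ℤ ℤ.+ (s ℤ.+ 0ℤ)) (uncovered ¬c)
        where
        ¬c : ¬ Covered M j
        ¬c c with find c
        ... | _ , e∈ , inj₁ refl = j∉ e∈
        ... | _ , e∈ , inj₂ ne≡j = i∉ (subst (_∈ M) (next-injective (trans ne≡j (sym next-i))) e∈)

  lift-zWeight : zWeight (lift M) ≡ m ⊖ length M
  lift-zWeight = begin
    zWeight (lift M)
      ≡⟨ ℤ.+-identityʳ (zWeight (lift M)) ⟨
    zWeight (lift M) ℤ.+ 0ℤ
      ≡⟨ cong (λ s → zWeight (lift M) ℤ.+ s) (ℤ.+-inverseʳ (+ length M)) ⟨
    zWeight (lift M) ℤ.+ (+ length M ℤ.- + length M)
      ≡⟨ ℤ.+-assoc (zWeight (lift M)) (+ length M) (ℤ.- + length M) ⟨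
    zWeight (lift M) ℤ.+ + length M ℤ.- + length M
      ≡⟨ cong (λ s → s ℤ.- + length M) total ⟩
    + m ℤ.- + length M
      ≡⟨ ℤ.[+m]-[+n]≡m⊖n m (length M) ⟩
    m ⊖ length M
      ∎
    where
    open ≡-Reasoning
    total : zWeight (lift M) ℤ.+ + length M ≡ + m
    total = begin
      zWeight (lift M) ℤ.+ + length M
        ≡⟨ cong₂ ℤ._+_ (trans (zWeight-select (lifted? M)) (sym (sumℤ-allFin n upward)))
                       (trans (length-as-sum τ) (sym (sumℤ-allFin n edges))) ⟩
      sumℤ (map upward (allFin n)) ℤ.+ sumℤ (map edges (allFin n))
        ≡⟨ sumℤ-map-+ upward edges (allFin n) ⟨
      sumℤ (map (λ j → upward j ℤ.+ edges j) (allFin n))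
        ≡⟨ sumℤ-allFin n (λ j → upward j ℤ.+ edges j) ⟩
      sumℤ (tabulate (λ j → upward j ℤ.+ edges j))
        ≡⟨ sumℤ-tabulate-pairs m (λ j → upward j ℤ.+ edges j) oneEdgePerPair ⟩
      + m
        ∎

-- Counting perfect matchings by weight

⊖-injectiveʳ : ∀ m {p q} → m ⊖ p ≡ m ⊖ q → p ≡ q
⊖-injectiveʳ m {p} {q} eq = ℤ.+-injective (ℤ.neg-injective (∙-cancelˡ (+ m) _ _
  (trans (ℤ.m-n≡m⊖n m p) (trans eq (sym (ℤ.m-n≡m⊖n m q))))))
  where open import Algebra.Properties.AbelianGroup ℤ.+-0-abelianGroup using (∙-cancelˡ)

-- Without repetitions, having the same members implies having the same multiplicities, so the lists
-- are permutations of each other.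
length-unique-set : {xs ys : List A} → Unique xs → Unique ys →
  (∀ {x} → x ∈ xs → x ∈ ys) → (∀ {x} → x ∈ ys → x ∈ xs) → length xs ≡ length ys
length-unique-set xs! ys! f g = ↭-length (∼bag⇒↭ (unique∧set⇒bag xs! ys! (mk⇔ f g)))

module _ (l : ℕ) where
  private
    m = suc l
    n = m ℕ.* 2
    E = hexagonEdges n

    2≤n : 2 ℕ.≤ n
    2≤n = s≤s (s≤s z≤n)

    2∣n : 2 ∣ n
    2∣n = divides m refl

    ofWeight? : ∀ i → Decidable (λ (K : List (StripEdge n)) → zWeight K ≡ i × wWeight K ≡ 0ℤ)
    ofWeight? i K = (zWeight K ℤ.≟ i) ×-dec (wWeight K ℤ.≟ 0ℤ)

    perfect⁻ : ∀ {K} → K ∈ Hex.perfectMatchings {n} → K ⊆ E × Hex.IsPerfectMatching K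
    perfect⁻ K∈ = let K∈E , perfect = ∈-filter⁻ Hex.isPerfectMatching? {xs = sublists E} K∈
                  in ∈-sublists⁻ E K∈E , perfect

    matching⁻ : ∀ {M} → M ∈ Cycle.matchings {n} → M ⊆ allFin n × Cycle.IsMatching M
    matching⁻ M∈ = let M∈S , matching = ∈-filter⁻ Cycle.isMatching? {xs = sublists (allFin n)} M∈
                   in ∈-sublists⁻ (allFin n) M∈S , matching

    matching⁺ : ∀ {M} → M ⊆ allFin n → Cycle.IsMatching M → M ∈ Cycle.matchings {n}
    matching⁺ τ matching = ∈-filter⁺ Cycle.isMatching? (∈-sublists⁺ τ) matching

    zWeight-project : ∀ {K} → K ⊆ E → Hex.IsPerfectMatching K → wWeight K ≡ 0ℤ →
                      zWeight K ≡ m ⊖ length (project K)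
    zWeight-project {K} τ perfect w≡0 =
      trans (cong zWeight (sym (lift-project 2∣n 2≤n τ perfect w≡0)))
            (lift-zWeight m (project-⊆ K) (project-matching 2∣n 2≤n τ perfect) 2≤n)

  N-hexagon≡a : ∀ p → N n E (m ⊖ p) 0ℤ ≡ a n p
  N-hexagon≡a p = trans (length-unique-set perfects! lifts! to from) (List.length-map lift matchings)
    where
    size? : Decidable (λ (M : List (Fin n)) → length M ≡ p)
    size? M = length M ℕ.≟ p
    perfects = filter (ofWeight? (m ⊖ p)) (Hex.perfectMatchings {n})
    matchings = filter size? (Cycle.matchings {n})

    perfects! : Unique perfects
    perfects! = Unique.filter⁺ (ofWeight? (m ⊖ p))
      (Unique.filter⁺ Hex.isPerfectMatching? (sublists-unique (hexagonEdges-unique n)))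

    lifts! : Unique (map lift matchings)
    -- Applying `project` gives back a list without repetitions, so the lifts cannot repeat either.
    lifts! = Unique.map⁻ {f = project} (subst Unique (sym project-lifts)
      (Unique.filter⁺ size? (Unique.filter⁺ Cycle.isMatching? (sublists-unique (Unique.allFin⁺ n)))))
      where
      project-lifts : map project (map lift matchings) ≡ matchings
      project-lifts = trans (sym (List.map-∘ matchings)) (List.map-id-local (All.tabulate λ M∈ →
        project-lift (proj₁ (matching⁻ (proj₁ (∈-filter⁻ size? {xs = Cycle.matchings} M∈))))))

    to : ∀ {K} → K ∈ perfects → K ∈ map lift matchings
    to {K} K∈ =
      let K∈P , z≡ , w≡0 = ∈-filter⁻ (ofWeight? (m ⊖ p)) {xs = Hex.perfectMatchings} K∈
          τ , perfect = perfect⁻ K∈P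
          M∈ = ∈-filter⁺ size?
            (matching⁺ (project-⊆ K) (project-matching 2∣n 2≤n τ perfect))
            (⊖-injectiveʳ m (trans (sym (zWeight-project τ perfect w≡0)) z≡))
      in subst (_∈ map lift matchings) (lift-project 2∣n 2≤n τ perfect w≡0) (∈-map⁺ lift M∈)

    from : ∀ {K} → K ∈ map lift matchings → K ∈ perfects
    from K∈ with ∈-map⁻ lift K∈
    ... | M , M∈ , refl =
      let M∈C , size = ∈-filter⁻ size? {xs = Cycle.matchings} M∈
          τ , matching = matching⁻ M∈C
      in ∈-filter⁺ (ofWeight? (m ⊖ p))
           (∈-filter⁺ Hex.isPerfectMatching? (∈-sublists⁺ (lift-⊆ M)) (lift-perfect {M = M} matching))
           (trans (lift-zWeight m τ matching 2≤n) (cong (m ⊖_) size) , lift-wWeight 2∣n M)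

  -- The z-weight is `m ⊖ ∣M∣`, hence at most `m`. This handles the exponents that are not of the
  -- form `m ⊖ p`.
  N-hexagon≡0 : ∀ q → N n E (+ (suc m ℕ.+ q)) 0ℤ ≡ 0
  N-hexagon≡0 q = cong length (List.filter-none (ofWeight? (+ (suc m ℕ.+ q)))
    (All.tabulate λ {K} K∈ (z≡ , w≡0) →
      let τ , perfect = perfect⁻ K∈ in
      contradiction
        (subst (ℤ._≤ + m) (trans (sym (zWeight-project τ perfect w≡0)) z≡) (ℤ.m⊖n≤m m (length (project K))))
        (λ { (ℤ.+≤+ m+q<m) → ℕ.<⇒≱ (s≤s (ℕ.m≤m+n m q)) m+q<m })))

-- The closed form of a n p

-- The source of the factor n/(n-p): it makes both binomial coefficients in `cycleCount` multiples
-- of a single one.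
absorption : ∀ n k → suc k ℕ.* (suc n C suc k) ≡ suc n ℕ.* (n C k)
absorption zero    zero    = refl
absorption zero    (suc k) = trans (cong (suc (suc k) ℕ.*_) (k>n⇒nCk≡0 (s≤s (s≤s (z≤n {k})))))
  (trans (ℕ.*-zeroʳ (suc (suc k))) (sym (cong (1 ℕ.*_) (k>n⇒nCk≡0 (s≤s (z≤n {k}))))))
absorption (suc n) zero    = begin
  1 ℕ.* (suc (suc n) C 1)                ≡⟨ cong (1 ℕ.*_) (nCk+nC[k+1]≡[n+1]C[k+1] (suc n) 0) ⟨
  1 ℕ.* (1 ℕ.+ (suc n C 1))              ≡⟨ ℕ.*-distribˡ-+ 1 1 (suc n C 1) ⟩
  1 ℕ.+ 1 ℕ.* (suc n C 1)                ≡⟨ cong (1 ℕ.+_) (absorption n zero) ⟩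
  1 ℕ.+ suc n ℕ.* 1                      ∎
  where open ≡-Reasoning
absorption (suc n) (suc k) = begin
  suc (suc k) ℕ.* (suc (suc n) C suc (suc k))
    ≡⟨ cong (suc (suc k) ℕ.*_) (nCk+nC[k+1]≡[n+1]C[k+1] (suc n) (suc k)) ⟨
  suc (suc k) ℕ.* (u ℕ.+ (suc n C suc (suc k)))
    ≡⟨ ℕ.*-distribˡ-+ (suc (suc k)) u (suc n C suc (suc k)) ⟩
  (u ℕ.+ suc k ℕ.* u) ℕ.+ suc (suc k) ℕ.* (suc n C suc (suc k))
    ≡⟨ cong₂ (λ s t → (u ℕ.+ s) ℕ.+ t) (absorption n k) (absorption n (suc k)) ⟩
  (u ℕ.+ suc n ℕ.* (n C k)) ℕ.+ suc n ℕ.* (n C suc k)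
    ≡⟨ ℕ.+-assoc u (suc n ℕ.* (n C k)) (suc n ℕ.* (n C suc k)) ⟩
  u ℕ.+ (suc n ℕ.* (n C k) ℕ.+ suc n ℕ.* (n C suc k))
    ≡⟨ cong (u ℕ.+_) (ℕ.*-distribˡ-+ (suc n) (n C k) (n C suc k)) ⟨
  u ℕ.+ suc n ℕ.* ((n C k) ℕ.+ (n C suc k))
    ≡⟨ cong (λ t → u ℕ.+ suc n ℕ.* t) (nCk+nC[k+1]≡[n+1]C[k+1] n k) ⟩
  u ℕ.+ suc n ℕ.* u
    ∎
  where
  open ≡-Reasoning
  u = suc n C suc k

-- The closed form with its denominator cleared. In the successor case absorption turns
-- `suc d * (d C p)` into `suc p * e`; together with `e * suc d` this is `e` times `suc p + suc d`,
-- which is the number of nodes.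
cycleCount-closed : ∀ m p → 2 ℕ.* p ℕ.≤ 2 ℕ.+ m →
  cycleCount m p ℕ.* (2 ℕ.+ m ℕ.∸ p) ≡ (2 ℕ.+ m) ℕ.* ((2 ℕ.+ m ℕ.∸ p) C p)
cycleCount-closed m zero    _     = trans (ℕ.*-identityˡ (2 ℕ.+ m)) (sym (ℕ.*-identityʳ (2 ℕ.+ m)))
cycleCount-closed m (suc p) 2p≤n = begin
  ((m ℕ.∸ p) C p ℕ.+ (suc m ℕ.∸ p) C suc p) ℕ.* (suc m ℕ.∸ p)
    ≡⟨ cong (λ t → ((m ℕ.∸ p) C p ℕ.+ t C suc p) ℕ.* t) 1+m∸p ⟩
  ((d C p) ℕ.+ e) ℕ.* suc d
    ≡⟨ solve 3 (λ b e d → (b :+ e) :* (con 1 :+ d) := (con 1 :+ d) :* b :+ e :* (con 1 :+ d)) refl (d C p) e d ⟩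
  suc d ℕ.* (d C p) ℕ.+ e ℕ.* suc d
    ≡⟨ cong (ℕ._+ e ℕ.* suc d) (absorption d p) ⟨
  suc p ℕ.* e ℕ.+ e ℕ.* suc d
    ≡⟨ solve 3 (λ p e d → (con 1 :+ p) :* e :+ e :* (con 1 :+ d) := (con 2 :+ (p :+ d)) :* e) refl p e d ⟩
  (2 ℕ.+ (p ℕ.+ d)) ℕ.* e
    ≡⟨ cong₂ (λ s t → (2 ℕ.+ s) ℕ.* (t C suc p)) (ℕ.m+[n∸m]≡n p≤m) (sym 1+m∸p) ⟩
  (2 ℕ.+ m) ℕ.* ((suc m ℕ.∸ p) C suc p)
    ∎
  where
  open ≡-Reasoning
  open ℕ.+-*-Solver
  d = m ℕ.∸ p
  e = suc d C suc p
  p≤m : p ℕ.≤ m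
  p≤m = ℕ.+-cancelˡ-≤ 2 p m (ℕ.≤-trans (s≤s (subst (suc p ℕ.≤_) (sym (ℕ.+-suc p _)) (s≤s (ℕ.m≤m+n p _)))) 2p≤n)
  1+m∸p : suc m ℕ.∸ p ≡ suc d
  1+m∸p = ℕ.+-∸-assoc 1 p≤m

cycleCount-vanishes : ∀ m p → 2 ℕ.+ m ℕ.< 2 ℕ.* p → cycleCount m p ≡ 0
cycleCount-vanishes m (suc p) n<2p = cong₂ ℕ._+_
  (k>n⇒nCk≡0 (ℕ.m<n+o⇒m∸n<o m p {{p≢0}} m<p+p))
  (k>n⇒nCk≡0 (ℕ.m<n+o⇒m∸n<o (suc m) p (subst (suc m ℕ.<_) (sym (ℕ.+-suc p p)) (s≤s m<p+p))))
  where
  m<p+p : m ℕ.< p ℕ.+ p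
  m<p+p = ℕ.≤-pred (ℕ.≤-pred (subst (2 ℕ.+ m ℕ.<_)
    (cong suc (trans (ℕ.+-suc p (p ℕ.+ 0)) (cong (λ t → suc (p ℕ.+ t)) (ℕ.+-identityʳ p)))) n<2p))
  p≢0 : NonZero p
  p≢0 = ℕ.≢-nonZero λ { refl → contradiction m<p+p λ () }

-- Fractions in lowest terms depend on greatest common divisors; for unnormalised fractions equality
-- is cross-multiplication, which is the hypothesis.
/1≡/*/1 : ∀ b c n d .{{_ : NonZero d}} → b ℕ.* d ≡ n ℕ.* c →
          + b ℚ./ 1 ≡ (+ n ℚ./ d) ℚ.* (+ c ℚ./ 1)
/1≡/*/1 b c n d@(suc d-1) eq = ℚ.toℚᵘ-injective (begin
  ℚ.toℚᵘ (+ b ℚ./ 1)                        ≈⟨ ℚ.toℚᵘ-fromℚᵘ (ℚᵘ.mkℚᵘ (+ b) 0) ⟩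
  ℚᵘ.mkℚᵘ (+ b) 0                           ≈⟨ ℚᵘ.*≡* cross ⟩
  ℚᵘ.mkℚᵘ (+ n) d-1 ℚᵘ.* ℚᵘ.mkℚᵘ (+ c) 0
    ≈⟨ ℚᵘ.*-cong (ℚ.toℚᵘ-fromℚᵘ (ℚᵘ.mkℚᵘ (+ n) d-1)) (ℚ.toℚᵘ-fromℚᵘ (ℚᵘ.mkℚᵘ (+ c) 0)) ⟨
  ℚ.toℚᵘ (+ n ℚ./ d) ℚᵘ.* ℚ.toℚᵘ (+ c ℚ./ 1)
    ≈⟨ ℚ.toℚᵘ-homo-* (+ n ℚ./ d) (+ c ℚ./ 1) ⟨
  ℚ.toℚᵘ ((+ n ℚ./ d) ℚ.* (+ c ℚ./ 1))      ∎)
  where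
  open ℚᵘ.≃-Reasoning
  cross : + b ℤ.* + (d ℕ.* 1) ≡ (+ n ℤ.* + c) ℤ.* + 1
  cross = trans (cong (λ t → + b ℤ.* + t) (ℕ.*-identityʳ d))
    (trans (sym (ℤ.pos-* b d)) (trans (cong +_ eq) (trans (ℤ.pos-* n c) (sym (ℤ.*-identityʳ (+ n ℤ.* + c))))))

-- The w⁰ part of the partition function

filter-≟ : ∀ {i} {xs : List ℤ} → Unique xs → i ∈ xs → filter (λ j → j ℤ.≟ i) xs ≡ i ∷ []
filter-≟ {i} {j ∷ xs} (i≢xs ∷ xs!) (here refl) =
  trans (List.filter-accept (λ j → j ℤ.≟ i) refl)
    (cong (i ∷_) (List.filter-none (λ j → j ℤ.≟ i) (All.map (λ i≢j j≡i → i≢j (sym j≡i)) i≢xs)))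
filter-≟ {i} {j ∷ xs} (j≢xs ∷ xs!) (there i∈) =
  trans (List.filter-reject (λ j → j ℤ.≟ i) (All.lookup j≢xs i∈)) (filter-≟ xs! i∈)

symmetricRange-unique : ∀ n → Unique (symmetricRange n)
symmetricRange-unique n = Unique.map⁺
  (λ eq → ℤ.+-injective (∙-cancelʳ (ℤ.- + n) _ _ eq)) (Unique.upTo⁺ (suc (2 ℕ.* n)))
  where open import Algebra.Properties.AbelianGroup ℤ.+-0-abelianGroup using (∙-cancelʳ)

0∈symmetricRange : ∀ n → 0ℤ ∈ symmetricRange n
0∈symmetricRange n = subst (_∈ symmetricRange n) (ℤ.+-inverseʳ (+ n))
  (∈-map⁺ (λ k → + k ℤ.- + n) (∈-upTo⁺ (s≤s (ℕ.m≤m+n n (n ℕ.+ 0)))))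

wConstantPart-concatMap : (c : ℤ → ℤ → ℤ) {js : List ℤ} → filter (λ j → j ℤ.≟ 0ℤ) js ≡ 0ℤ ∷ [] →
  (is : List ℤ) →
  wConstantPart (concatMap (λ i → map (λ j → c i j , i , j) js) is) ≡ map (λ i → c i 0ℤ , i) is
wConstantPart-concatMap c eq [] = refl
wConstantPart-concatMap c {js} eq (i ∷ is) = begin
  map forget (filter w⁰? (row i ++ concatMap row is))
    ≡⟨ cong (map forget) (List.filter-++ w⁰? (row i) (concatMap row is)) ⟩
  map forget (filter w⁰? (row i) ++ filter w⁰? (concatMap row is))
    ≡⟨ List.map-++ forget (filter w⁰? (row i)) (filter w⁰? (concatMap row is)) ⟩
  map forget (filter w⁰? (row i)) ++ wConstantPart (concatMap row is)
    ≡⟨ cong₂ (λ L L′ → map forget L ++ L′)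
         (trans (filter-map w⁰? (λ j → c i j , i , j) js) (cong (map (λ j → c i j , i , j)) eq))
         (wConstantPart-concatMap c eq is) ⟩
  map (λ i → c i 0ℤ , i) (i ∷ is)
    ∎
  where
  open ≡-Reasoning
  row : ℤ → Laurent₂
  row i = map (λ j → c i j , i , j) js
  forget : ℤ × ℤ × ℤ → ℤ × ℤ
  forget (c , i , _) = c , i
  w⁰? : Decidable (λ ((_ , _ , j) : ℤ × ℤ × ℤ) → j ≡ 0ℤ)
  w⁰? (_ , _ , j) = j ℤ.≟ 0ℤ

-- At `w⁰` the sign exponent n_z + n_w + n_z n_w reduces to n_z.
Phex-coefficients : ∀ n →
  Phex n ≡ map (λ i → sign i ℤ.* + N n (hexagonEdges n) i 0ℤ , i) (symmetricRange n)
Phex-coefficients n = trans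
  (wConstantPart-concatMap (λ i j → sign (i ℤ.+ j ℤ.+ i ℤ.* j) ℤ.* + N n (hexagonEdges n) i j)
    {symmetricRange n} (filter-≟ (symmetricRange-unique n) (0∈symmetricRange n)) (symmetricRange n))
  (List.map-cong (λ i → cong (λ k → sign k ℤ.* + N n (hexagonEdges n) i 0ℤ , i) (exponent i))
    (symmetricRange n))
  where
  exponent : ∀ i → i ℤ.+ 0ℤ ℤ.+ i ℤ.* 0ℤ ≡ i
  exponent i = trans (cong₂ ℤ._+_ (ℤ.+-identityʳ i) (ℤ.*-zeroʳ i)) (ℤ.+-identityʳ i)

-- Evaluation in a commutative ring

module Ring {c ℓ} (R : CommutativeRing c ℓ) where

  open Evaluation R
  open CommutativeRing R hiding (Carrier; _≈_; _+_; _*_; _-_; 0#; 1#; -_; refl; sym; trans; zero)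
  open CommutativeRing R using () renaming (refl to ≈-refl; sym to ≈-sym; trans to ≈-trans)
  open import Algebra.Properties.CommutativeMonoid.Sum +-commutativeMonoid
    using (sum-cong-≋; sum-replicate-zero; sum-permute; ∑-distrib-+)
  open import Algebra.Properties.Semiring.Sum semiring using (*-distribˡ-sum)
  open import Algebra.Properties.Semiring.Mult semiring using (×-homo-+; ×-comm-*)
  open import Algebra.Properties.Semiring.Exp semiring using (^-congˡ)
  open import Algebra.Properties.CommutativeSemiring.Exp commutativeSemiring using (^-distrib-*)
  open import Algebra.Properties.Ring ring using (-1*x≈-x; -‿involutive; -0#≈0#)
  open import Algebra.Solver.Ring.NaturalCoefficients.Default commutativeSemiring
  open import Relation.Binary.Reasoning.Setoid setoid

  sum-++ : ∀ m n (f : ℕ → Carrier) →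
    sum {m ℕ.+ n} (f ∘ toℕ) ≈ sum {m} (f ∘ toℕ) + sum {n} (λ i → f (m ℕ.+ toℕ i))
  sum-++ zero    n f = ≈-sym (+-identityˡ _)
  sum-++ (suc m) n f = ≈-trans (+-congˡ (sum-++ m n (f ∘ suc))) (≈-sym (+-assoc _ _ _))

  sum-zero : ∀ {n} (f : Fin n → Carrier) → (∀ i → f i ≈ 0#) → sum f ≈ 0#
  sum-zero {n} f f≈0 = ≈-trans (sum-cong-≋ f≈0) (sum-replicate-zero n)

  -- `symmetricRange` lists exponents in increasing order, whereas `m ⊖ p` decreases with the number
  -- `p` of edges.
  sum-reverse : ∀ n (f : ℕ → Carrier) →
    sum {suc n} (f ∘ toℕ) ≈ sum {suc n} (λ i → f (n ℕ.∸ toℕ i))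
  sum-reverse n f = ≈-trans (sum-permute {suc n} (f ∘ toℕ) Perm.reverse)
    (sum-cong-≋ {suc n} (λ i → reflexive (cong f (Fin.opposite-prop i))))

  fromℤ-neg : ∀ i → fromℤ (ℤ.- i) ≈ neg (fromℤ i)
  fromℤ-neg (+ zero)  = ≈-sym -0#≈0#
  fromℤ-neg (+ suc k) = ≈-refl
  fromℤ-neg -[1+ k ]  = ≈-sym (-‿involutive _)

  fromℤ-sign-* : ∀ i b → fromℤ (sign i ℤ.* + b) ≈ neg 1# ^ ℤ.∣ i ∣ * (b · 1#)
  fromℤ-sign-* i b = go ℤ.∣ i ∣
    where
    go : ∀ k → fromℤ ((-1ℤ ℤ.^ k) ℤ.* + b) ≈ neg 1# ^ k * (b · 1#)
    go zero    = ≈-trans (reflexive (cong fromℤ (ℤ.*-identityˡ (+ b)))) (≈-sym (*-identityˡ _))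
    go (suc k) = begin
      fromℤ ((-1ℤ ℤ.* (-1ℤ ℤ.^ k)) ℤ.* + b)
        ≡⟨ cong fromℤ (trans (ℤ.*-assoc -1ℤ (-1ℤ ℤ.^ k) (+ b)) (ℤ.-1*i≡-i ((-1ℤ ℤ.^ k) ℤ.* + b))) ⟩
      fromℤ (ℤ.- ((-1ℤ ℤ.^ k) ℤ.* + b))   ≈⟨ fromℤ-neg ((-1ℤ ℤ.^ k) ℤ.* + b) ⟩
      neg (fromℤ ((-1ℤ ℤ.^ k) ℤ.* + b))   ≈⟨ -‿cong (go k) ⟩
      neg (neg 1# ^ k * (b · 1#))           ≈⟨ -1*x≈-x _ ⟨
      neg 1# * (neg 1# ^ k * (b · 1#))      ≈⟨ *-assoc _ _ _ ⟨
      neg 1# ^ suc k * (b · 1#)             ∎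

  -- Serves both for `z` with its inverse and for `-1`, which is its own inverse.
  ^-cancel : ∀ {u u⁻¹} → u * u⁻¹ ≈ 1# → ∀ m p → u ^ suc m * u⁻¹ ^ suc p ≈ u ^ m * u⁻¹ ^ p
  ^-cancel {u} {u⁻¹} uu⁻¹≈1 m p = begin
    (u * u ^ m) * (u⁻¹ * u⁻¹ ^ p)
      ≈⟨ solve 4 (λ u u⁻¹ s t → (u :* s) :* (u⁻¹ :* t) := (u :* u⁻¹) :* (s :* t)) ≈-refl u u⁻¹ (u ^ m) (u⁻¹ ^ p) ⟩
    (u * u⁻¹) * (u ^ m * u⁻¹ ^ p)   ≈⟨ *-congʳ uu⁻¹≈1 ⟩
    1# * (u ^ m * u⁻¹ ^ p)          ≈⟨ *-identityˡ _ ⟩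
    u ^ m * u⁻¹ ^ p                 ∎

  power-⊖ : ∀ {z z⁻¹} → z * z⁻¹ ≈ 1# → ∀ m p → power z z⁻¹ (m ⊖ p) ≈ z ^ m * z⁻¹ ^ p
  power-⊖ zz⁻¹≈1 m       zero    = ≈-sym (*-identityʳ _)
  power-⊖ zz⁻¹≈1 zero    (suc p) = ≈-sym (*-identityˡ _)
  power-⊖ {z} {z⁻¹} zz⁻¹≈1 (suc m) (suc p) = begin
    power z z⁻¹ (suc m ⊖ suc p)   ≡⟨ cong (power z z⁻¹) (ℤ.[1+m]⊖[1+n]≡m⊖n m p) ⟩
    power z z⁻¹ (m ⊖ p)           ≈⟨ power-⊖ zz⁻¹≈1 m p ⟩
    z ^ m * z⁻¹ ^ p               ≈⟨ ^-cancel zz⁻¹≈1 m p ⟨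
    z ^ suc m * z⁻¹ ^ suc p       ∎

  neg1^∣⊖∣ : ∀ m p → neg 1# ^ ℤ.∣ m ⊖ p ∣ ≈ neg 1# ^ m * neg 1# ^ p
  neg1^∣⊖∣ m       zero    = ≈-sym (*-identityʳ _)
  neg1^∣⊖∣ zero    (suc p) = ≈-sym (*-identityˡ _)
  neg1^∣⊖∣ (suc m) (suc p) = begin
    neg 1# ^ ℤ.∣ suc m ⊖ suc p ∣    ≡⟨ cong (λ i → neg 1# ^ ℤ.∣ i ∣) (ℤ.[1+m]⊖[1+n]≡m⊖n m p) ⟩
    neg 1# ^ ℤ.∣ m ⊖ p ∣            ≈⟨ neg1^∣⊖∣ m p ⟩
    neg 1# ^ m * neg 1# ^ p         ≈⟨ ^-cancel (≈-trans (-1*x≈-x (neg 1#)) (-‿involutive 1#)) m p ⟨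
    neg 1# ^ suc m * neg 1# ^ suc p ∎

  signedSum : ℕ → Carrier → Carrier
  signedSum n w = sum {suc n} (λ p → neg 1# ^ toℕ p * w ^ toℕ p * (a n (toℕ p) · 1#))

  module _ (z z⁻¹ : Carrier) where

    monomial : ℤ × ℤ → Carrier
    monomial (c , i) = fromℤ c * power z z⁻¹ i

    eval-applyUpTo : (g : ℕ → ℤ × ℤ) (f : ℕ → ℕ) (k : ℕ) →
      foldr (λ e s → monomial e + s) 0# (map g (applyUpTo f k)) ≡ sum {k} (λ i → monomial (g (f (toℕ i))))
    eval-applyUpTo g f zero    = refl
    eval-applyUpTo g f (suc k) = cong (λ s → monomial (g (f 0)) + s) (eval-applyUpTo g (f ∘ suc) k)

    module _ (zz⁻¹≈1 : z * z⁻¹ ≈ 1#) (l : ℕ) where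
      private
        m = suc l
        n = m ℕ.* 2

        coefficient : ℤ → ℤ × ℤ
        coefficient i = sign i ℤ.* + N n (hexagonEdges n) i 0ℤ , i

        term : ℤ → Carrier
        term i = monomial (coefficient i)

        f : ℕ → Carrier
        f k = term (+ k ℤ.- + n)

      -- The first factor does not depend on `p`: here the global sign (-1)^m and the power z^m
      -- separate from the sum.
      term-⊖ : ∀ p → term (m ⊖ p) ≈
               (neg 1# ^ m * z ^ m) * (neg 1# ^ p * z⁻¹ ^ p * (a n p · 1#))
      term-⊖ p = begin
        fromℤ (sign (m ⊖ p) ℤ.* + N n (hexagonEdges n) (m ⊖ p) 0ℤ) * power z z⁻¹ (m ⊖ p)
          ≈⟨ *-cong (fromℤ-sign-* (m ⊖ p) (N n (hexagonEdges n) (m ⊖ p) 0ℤ)) (power-⊖ zz⁻¹≈1 m p) ⟩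
        (neg 1# ^ ℤ.∣ m ⊖ p ∣ * (N n (hexagonEdges n) (m ⊖ p) 0ℤ · 1#)) * (z ^ m * z⁻¹ ^ p)
          ≈⟨ *-congʳ (*-cong (neg1^∣⊖∣ m p) (reflexive (cong (_· 1#) (N-hexagon≡a l p)))) ⟩
        ((neg 1# ^ m * neg 1# ^ p) * (a n p · 1#)) * (z ^ m * z⁻¹ ^ p)
          ≈⟨ solve 5 (λ s t b u w → ((s :* t) :* b) :* (u :* w) := (s :* u) :* ((t :* w) :* b)) ≈-refl
               (neg 1# ^ m) (neg 1# ^ p) (a n p · 1#) (z ^ m) (z⁻¹ ^ p) ⟩
        (neg 1# ^ m * z ^ m) * (neg 1# ^ p * z⁻¹ ^ p * (a n p · 1#))
          ∎

      term≈0 : ∀ i → N n (hexagonEdges n) i 0ℤ ≡ 0 → term i ≈ 0#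
      term≈0 i N≡0 = begin
        fromℤ (sign i ℤ.* + N n (hexagonEdges n) i 0ℤ) * power z z⁻¹ i
          ≡⟨ cong (λ b → fromℤ (sign i ℤ.* + b) * power z z⁻¹ i) N≡0 ⟩
        fromℤ (sign i ℤ.* 0ℤ) * power z z⁻¹ i
          ≡⟨ cong (λ k → fromℤ k * power z z⁻¹ i) (ℤ.*-zeroʳ (sign i)) ⟩
        0# * power z z⁻¹ i
          ≈⟨ zeroˡ _ ⟩
        0#
          ∎

      -- The exponents below `-m` have the form `m ⊖ q` with `2 * q` greater than `n`, and no
      -- matching has that many edges.
      low : ∀ k → k ℕ.< m → f k ≈ 0#
      low k k<m = term≈0 (+ k ℤ.- + n) (trans (cong (λ i → N n (hexagonEdges n) i 0ℤ) exponent)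
        (trans (N-hexagon≡a l q) (trans (a≡cycleCount (l ℕ.* 2) q) (cycleCount-vanishes (l ℕ.* 2) q n<2q))))
        where
        q = m ℕ.+ (n ℕ.∸ k)
        k<n : k ℕ.< n
        k<n = ℕ.≤-trans k<m (ℕ.m≤m*n m 2)
        exponent : + k ℤ.- + n ≡ m ⊖ q
        exponent = trans (ℤ.m-n≡m⊖n k n) (trans
          (cong₂ _⊖_ (sym (ℕ.+-identityʳ k)) (sym (ℕ.m+[n∸m]≡n (ℕ.<⇒≤ k<n))))
          (trans (ℤ.+-cancelˡ-⊖ k 0 (n ℕ.∸ k)) (trans (sym (ℤ.+-cancelˡ-⊖ m 0 (n ℕ.∸ k)))
                 (cong (_⊖ q) (ℕ.+-identityʳ m)))))
        n<2q : n ℕ.< 2 ℕ.* q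
        n<2q = subst (ℕ._< 2 ℕ.* q) (ℕ.*-comm 2 m)
          (ℕ.*-monoʳ-< 2 (ℕ.m<m+n m (ℕ.m<n⇒0<n∸m k<n)))

      high : ∀ k → f (m ℕ.+ (suc n ℕ.+ k)) ≈ 0#
      high k = term≈0 (+ (m ℕ.+ (suc n ℕ.+ k)) ℤ.- + n)
        (trans (cong (λ i → N n (hexagonEdges n) i 0ℤ) exponent) (N-hexagon≡0 l k))
        where
        exponent : + (m ℕ.+ (suc n ℕ.+ k)) ℤ.- + n ≡ + (suc m ℕ.+ k)
        exponent = trans (ℤ.m-n≡m⊖n (m ℕ.+ (suc n ℕ.+ k)) n) (trans
          (cong₂ _⊖_ (ℕ-solve 3 (λ m n k → m ⊕ (ℕ-con 1 ⊕ n ⊕ k) ⊜ n ⊕ (ℕ-con 1 ⊕ m ⊕ k)) refl m n k)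
                     (sym (ℕ.+-identityʳ n)))
          (ℤ.+-cancelˡ-⊖ n (suc m ℕ.+ k) 0))
          where open ℕ.+-*-Solver using () renaming (solve to ℕ-solve; _:+_ to _⊕_; _:=_ to _⊜_; con to ℕ-con)

      middle : ∀ p → p ℕ.≤ n → f (m ℕ.+ (n ℕ.∸ p)) ≈ term (m ⊖ p)
      middle p p≤n = reflexive (cong term (trans (ℤ.m-n≡m⊖n (m ℕ.+ (n ℕ.∸ p)) n) (trans
        (cong₂ _⊖_ (ℕ.+-comm m (n ℕ.∸ p)) (sym (ℕ.m∸n+n≡m p≤n)))
        (ℤ.+-cancelˡ-⊖ (n ℕ.∸ p) m p))))

      -- The `2 n + 1` exponents fall into `m` below `-m`, the `n + 1` from `-m` to `m`, and `m`
      -- above `m`. Only the middle block contributes, and reversed it is indexed by `p` from `0` to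
      -- `n`.
      eval-Phex : eval (Phex n) z z⁻¹ ≈
        neg 1# ^ m * (z ^ m * signedSum n z⁻¹)
      eval-Phex = begin
        eval (Phex n) z z⁻¹
          ≡⟨ cong (λ P → eval P z z⁻¹) (trans (Phex-coefficients n) (sym (List.map-∘ (upTo (suc (2 ℕ.* n)))))) ⟩
        eval (map (λ k → coefficient (+ k ℤ.- + n)) (upTo (suc (2 ℕ.* n)))) z z⁻¹
          ≡⟨ eval-applyUpTo (λ k → coefficient (+ k ℤ.- + n)) id (suc (2 ℕ.* n)) ⟩
        sum {suc (2 ℕ.* n)} (f ∘ toℕ)
          ≡⟨ cong (λ k → sum {k} (f ∘ toℕ)) split ⟩
        sum {m ℕ.+ (suc n ℕ.+ m)} (f ∘ toℕ)
          ≈⟨ sum-++ m (suc n ℕ.+ m) f ⟩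
        sum {m} (f ∘ toℕ) + sum {suc n ℕ.+ m} (λ i → f (m ℕ.+ toℕ i))
          ≈⟨ +-cong (sum-zero {m} (f ∘ toℕ) (λ i → low (toℕ i) (Fin.toℕ<n i)))
                    (sum-++ (suc n) m (λ k → f (m ℕ.+ k))) ⟩
        0# + (sum {suc n} (λ i → f (m ℕ.+ toℕ i)) + sum {m} (λ i → f (m ℕ.+ (suc n ℕ.+ toℕ i))))
          ≈⟨ ≈-trans (+-identityˡ _) (+-congˡ (sum-zero {m} (λ i → f (m ℕ.+ (suc n ℕ.+ toℕ i))) (λ i → high (toℕ i)))) ⟩
        sum {suc n} (λ i → f (m ℕ.+ toℕ i)) + 0#
          ≈⟨ +-identityʳ _ ⟩
        sum {suc n} (λ i → f (m ℕ.+ toℕ i))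
          ≈⟨ sum-reverse n (λ k → f (m ℕ.+ k)) ⟩
        sum {suc n} (λ i → f (m ℕ.+ (n ℕ.∸ toℕ i)))
          ≈⟨ sum-cong-≋ (λ i → ≈-trans (middle (toℕ i) (ℕ.≤-pred (Fin.toℕ<n i))) (term-⊖ (toℕ i))) ⟩
        sum {suc n} (λ i → (neg 1# ^ m * z ^ m) * summand i)
          ≈⟨ *-distribˡ-sum (neg 1# ^ m * z ^ m) summand ⟨
        (neg 1# ^ m * z ^ m) * sum summand
          ≈⟨ *-assoc _ _ _ ⟩
        neg 1# ^ m * (z ^ m * sum summand)
          ∎
        where
        summand : Fin (suc n) → Carrier
        summand p = neg 1# ^ toℕ p * z⁻¹ ^ toℕ p * (a n (toℕ p) · 1#)
        split : suc (2 ℕ.* n) ≡ m ℕ.+ (suc n ℕ.+ m)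
        split = trans (cong (λ t → suc (n ℕ.+ t)) (trans (ℕ.+-identityʳ n) (ℕ.*-comm m 2)))
          (ℕ-solve 2 (λ m n → ℕ-con 1 ⊕ (n ⊕ (m ⊕ (m ⊕ ℕ-con 0))) ⊜ m ⊕ (ℕ-con 1 ⊕ n ⊕ m)) refl m n)
          where open ℕ.+-*-Solver using () renaming (solve to ℕ-solve; _:+_ to _⊕_; _:=_ to _⊜_; con to ℕ-con)

  signedSum≈Q : ∀ n w → signedSum n w ≈ Q n (neg w)
  signedSum≈Q n w = sum-cong-≋ {suc n} λ p → ≈-trans (*-comm _ (a n (toℕ p) · 1#))
    (*-congˡ (≈-trans (≈-sym (^-distrib-* (neg 1#) w (toℕ p))) (^-congˡ (toℕ p) (-1*x≈-x w))))

  -- Generating polynomials of the matchings of paths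

  module _ (q : Carrier) where

    -- The number `b` of summands is independent of `m`: splitting off the constant term shortens
    -- the sum by one while Pascal's rule changes `m` by one or two. Any `b` above `m` yields the
    -- whole polynomial.
    pathSum : ℕ → ℕ → Carrier
    pathSum b m = sum {b} (λ p → (((m ℕ.∸ toℕ p) C toℕ p) · 1#) * q ^ toℕ p)

    pathPoly : ℕ → Carrier
    pathPoly 0             = 1#
    pathPoly 1             = 1#
    pathPoly (suc (suc m)) = pathPoly (suc m) + q * pathPoly m

    coefficient-+ : ∀ b c p →
      ((b ℕ.+ c) · 1#) * q ^ suc p ≈ q * ((b · 1#) * q ^ p) + (c · 1#) * q ^ suc p
    coefficient-+ b c p = ≈-trans (*-congʳ (×-homo-+ 1# b c))
      (solve 4 (λ b c q w → (b :+ c) :* (q :* w) := q :* (b :* w) :+ c :* (q :* w)) ≈-refl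
             (b · 1#) (c · 1#) q (q ^ p))

    constant : ∀ {r} → (1 · 1#) * 1# + r ≈ 1# + r
    constant = +-congʳ (≈-trans (*-identityʳ _) (+-identityʳ 1#))

    sum-coefficients : ∀ b (c d : ℕ → ℕ) →
      sum {b} (λ p → ((c (toℕ p) ℕ.+ d (toℕ p)) · 1#) * q ^ suc (toℕ p)) ≈
      q * sum {b} (λ p → (c (toℕ p) · 1#) * q ^ toℕ p) + sum {b} (λ p → (d (toℕ p) · 1#) * q ^ suc (toℕ p))
    sum-coefficients b c d = begin
      sum {b} (λ p → ((c (toℕ p) ℕ.+ d (toℕ p)) · 1#) * q ^ suc (toℕ p))
        ≈⟨ sum-cong-≋ {b} (λ p → coefficient-+ (c (toℕ p)) (d (toℕ p)) (toℕ p)) ⟩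
      sum {b} (λ p → q * ((c (toℕ p) · 1#) * q ^ toℕ p) + (d (toℕ p) · 1#) * q ^ suc (toℕ p))
        ≈⟨ ∑-distrib-+ {b} (λ p → q * ((c (toℕ p) · 1#) * q ^ toℕ p)) (λ p → (d (toℕ p) · 1#) * q ^ suc (toℕ p)) ⟩
      sum {b} (λ p → q * ((c (toℕ p) · 1#) * q ^ toℕ p)) + sum {b} (λ p → (d (toℕ p) · 1#) * q ^ suc (toℕ p))
        ≈⟨ +-congʳ (*-distribˡ-sum {b} q (λ p → (c (toℕ p) · 1#) * q ^ toℕ p)) ⟨
      q * sum {b} (λ p → (c (toℕ p) · 1#) * q ^ toℕ p) + sum {b} (λ p → (d (toℕ p) · 1#) * q ^ suc (toℕ p))
        ∎

    pathSum≈pathPoly : ∀ b m → m ℕ.< b → pathSum b m ≈ pathPoly m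
    pathSum≈pathPoly (suc b) zero _ = ≈-trans constant (≈-trans (+-congˡ (sum-zero {b} _ λ p →
      ≈-trans (*-congʳ (reflexive (cong (_· 1#) (k>n⇒nCk≡0 (s≤s (z≤n {toℕ p})))))) (zeroˡ _))) (+-identityʳ 1#))
    pathSum≈pathPoly (suc b) (suc zero) _ = ≈-trans constant (≈-trans (+-congˡ (sum-zero {b} _ λ p →
      ≈-trans (*-congʳ (reflexive (cong (_· 1#) ([0∸p]C[1+p]≡0 (toℕ p))))) (zeroˡ _))) (+-identityʳ 1#))
    pathSum≈pathPoly (suc b) (suc (suc m)) (s≤s m<b) = begin
      pathSum (suc b) (suc (suc m))
        ≈⟨ +-congˡ (sum-cong-≋ {b} λ p →
             *-congʳ {q ^ suc (toℕ p)} (reflexive (cong (_· 1#) (pathPascal m (toℕ p))))) ⟩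
      (1 · 1#) * 1# + sum {b} (λ p → (((m ℕ.∸ toℕ p) C toℕ p ℕ.+ (m ℕ.∸ toℕ p) C suc (toℕ p)) · 1#) * q ^ suc (toℕ p))
        ≈⟨ +-congˡ (sum-coefficients b (λ p → (m ℕ.∸ p) C p) (λ p → (m ℕ.∸ p) C suc p)) ⟩
      (1 · 1#) * 1# + (q * pathSum b m + sum {b} (λ p → (((m ℕ.∸ toℕ p) C suc (toℕ p)) · 1#) * q ^ suc (toℕ p)))
        ≈⟨ solve 3 (λ c s t → c :+ (s :+ t) := (c :+ t) :+ s) ≈-refl ((1 · 1#) * 1#) (q * pathSum b m) _ ⟩
      pathSum (suc b) (suc m) + q * pathSum b m
        ≈⟨ +-cong (pathSum≈pathPoly (suc b) (suc m) (ℕ.m≤n⇒m≤1+n m<b))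
                  (*-congˡ (pathSum≈pathPoly b m (ℕ.<⇒≤ m<b))) ⟩
      pathPoly (suc m) + q * pathPoly m
        ∎

    -- The two binomial coefficients of `cycleCount` as polynomials. Expressing `Q` through path
    -- polynomials lets it inherit their recurrence.
    Q≈pathPoly : ∀ m → Q (2 ℕ.+ m) q ≈ pathPoly (2 ℕ.+ m) + q * pathPoly m
    Q≈pathPoly m = begin
      Q n q
        ≈⟨ sum-cong-≋ {suc n} (λ p → *-congʳ {q ^ toℕ p} (reflexive (cong (_· 1#) (a≡cycleCount m (toℕ p))))) ⟩
      (1 · 1#) * 1# + sum {n} (λ p → (((m ℕ.∸ toℕ p) C toℕ p ℕ.+ (suc m ℕ.∸ toℕ p) C suc (toℕ p)) · 1#) * q ^ suc (toℕ p))
        ≈⟨ +-congˡ (sum-coefficients n (λ p → (m ℕ.∸ p) C p) (λ p → (suc m ℕ.∸ p) C suc p)) ⟩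
      (1 · 1#) * 1# + (q * pathSum n m + sum {n} (λ p → (((suc m ℕ.∸ toℕ p) C suc (toℕ p)) · 1#) * q ^ suc (toℕ p)))
        ≈⟨ solve 3 (λ c s t → c :+ (s :+ t) := (c :+ t) :+ s) ≈-refl ((1 · 1#) * 1#) (q * pathSum n m) _ ⟩
      pathSum (suc n) n + q * pathSum n m
        ≈⟨ +-cong (pathSum≈pathPoly (suc n) n ℕ.≤-refl) (*-congˡ (pathSum≈pathPoly n m (ℕ.m≤n+m (suc m) 1))) ⟩
      pathPoly n + q * pathPoly m
        ∎
      where n = 2 ℕ.+ m

    -- The Lucas recurrence and its characteristic roots

    Recurrent : (ℕ → Carrier) → Set ℓ
    Recurrent u = ∀ k → u (2 ℕ.+ k) ≈ u (1 ℕ.+ k) + q * u k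

    recurrent-unique : ∀ {u w} → Recurrent u → Recurrent w → u 0 ≈ w 0 → u 1 ≈ w 1 → ∀ k → u k ≈ w k
    recurrent-unique ru rw u₀ u₁ zero          = u₀
    recurrent-unique ru rw u₀ u₁ (suc zero)    = u₁
    recurrent-unique ru rw u₀ u₁ (suc (suc k)) = ≈-trans (ru k) (≈-trans
      (+-cong (recurrent-unique ru rw u₀ u₁ (suc k)) (*-congˡ (recurrent-unique ru rw u₀ u₁ k)))
      (≈-sym (rw k)))

    recurrent-+ : ∀ {u w} → Recurrent u → Recurrent w → Recurrent (λ k → u k + w k)
    recurrent-+ {u} {w} ru rw k = ≈-trans (+-cong (ru k) (rw k))
      (solve 5 (λ q a b c d → (a :+ q :* b) :+ (c :+ q :* d) := (a :+ c) :+ q :* (b :+ d)) ≈-refl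
             q (u (suc k)) (u k) (w (suc k)) (w k))

    recurrent-* : ∀ {u} c → Recurrent u → Recurrent (λ k → c * u k)
    recurrent-* {u} c ru k = ≈-trans (*-congˡ (ru k))
      (solve 4 (λ q c a b → c :* (a :+ q :* b) := c :* a :+ q :* (c :* b)) ≈-refl q c (u (suc k)) (u k))

    recurrent-^ : ∀ {x} → x * x ≈ x + q → Recurrent (x ^_)
    recurrent-^ {x} xx≈x+q k = begin
      x * (x * x ^ k)       ≈⟨ *-assoc x x (x ^ k) ⟨
      (x * x) * x ^ k       ≈⟨ *-congʳ xx≈x+q ⟩
      (x + q) * x ^ k       ≈⟨ distribʳ (x ^ k) x q ⟩
      x * x ^ k + q * x ^ k ∎

    -- The expression of `Q` by paths starts at two nodes, so the initial values are compared at 2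
    -- and 3 nodes, where they are 1 + 2q and 1 + 3q. The power sums reach these values by the
    -- recurrence from 2 and `x + y ≈ 1#`.
    Q≈x^n+y^n : ∀ {x y} → x + y ≈ 1# → x * x ≈ x + q → y * y ≈ y + q →
                ∀ m → Q (2 ℕ.+ m) q ≈ x ^ (2 ℕ.+ m) + y ^ (2 ℕ.+ m)
    Q≈x^n+y^n {x} {y} x+y≈1 xx≈x+q yy≈y+q m = ≈-trans (Q≈pathPoly m)
      (recurrent-unique {λ k → pathPoly (2 ℕ.+ k) + q * pathPoly k} {λ k → x ^ (2 ℕ.+ k) + y ^ (2 ℕ.+ k)}
        (recurrent-+ {λ k → pathPoly (2 ℕ.+ k)} (λ k → ≈-refl) (recurrent-* {pathPoly} q (λ k → ≈-refl)))
        (λ k → sumRec (2 ℕ.+ k)) base₀ base₁ m)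
      where
      sumRec : Recurrent (λ k → x ^ k + y ^ k)
      sumRec = recurrent-+ (recurrent-^ xx≈x+q) (recurrent-^ yy≈y+q)
      power₁ : x ^ 1 + y ^ 1 ≈ 1#
      power₁ = ≈-trans (+-cong (*-identityʳ x) (*-identityʳ y)) x+y≈1
      base₀ : (1# + q * 1#) + q * 1# ≈ x ^ 2 + y ^ 2
      base₀ = ≈-sym (≈-trans (sumRec 0) (≈-trans (+-congʳ power₁)
        (solve 1 (λ q → con 1 :+ q :* (con 1 :+ con 1) := (con 1 :+ q :* con 1) :+ q :* con 1) ≈-refl q)))
      base₁ : ((1# + q * 1#) + q * 1#) + q * 1# ≈ x ^ 3 + y ^ 3
      base₁ = ≈-sym (≈-trans (sumRec 1) (+-cong (≈-sym base₀) (*-congˡ power₁)))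

    -- The quadratic formula for x² = x + q. Its form without subtraction makes it a semiring
    -- identity and gives the second root by replacing `s` with `neg s`.
    halfRoot : ∀ {½ s} → (1# + 1#) * ½ ≈ 1# → s * s ≈ 1# + 4 · q →
               (½ * (1# + s)) * (½ * (1# + s)) ≈ ½ * (1# + s) + q
    halfRoot {½} {s} 2½≈1 ss≈ = begin
      (½ * (1# + s)) * (½ * (1# + s))
        ≈⟨ solve 2 (λ t s → (t :* (con 1 :+ s)) :* (t :* (con 1 :+ s)) := (t :* t) :* ((con 1 :+ s :+ s) :+ s :* s)) ≈-refl ½ s ⟩
      (½ * ½) * ((1# + s + s) + s * s)
        ≈⟨ *-congˡ (+-congˡ ss≈) ⟩
      (½ * ½) * ((1# + s + s) + (1# + 4 · q))
        -- Each factor 2 is paired with one factor `½`. The nested sum of four copies of `q` is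
        -- `4 · q` unfolded.
        ≈⟨ solve 3 (λ t s q → (t :* t) :* ((con 1 :+ s :+ s) :+ (con 1 :+ (q :+ (q :+ (q :+ (q :+ con 0))))))
             := ((con 1 :+ con 1) :* t) :* (t :* (con 1 :+ s)) :+ (((con 1 :+ con 1) :* t) :* ((con 1 :+ con 1) :* t)) :* q) ≈-refl ½ s q ⟩
      ((1# + 1#) * ½) * (½ * (1# + s)) + (((1# + 1#) * ½) * ((1# + 1#) * ½)) * q
        ≈⟨ +-cong (*-congʳ 2½≈1) (*-congʳ (*-cong 2½≈1 2½≈1)) ⟩
      1# * (½ * (1# + s)) + (1# * 1#) * q
        ≈⟨ solve 2 (λ x q → con 1 :* x :+ (con 1 :* con 1) :* q := x :+ q) ≈-refl (½ * (1# + s)) q ⟩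
      ½ * (1# + s) + q
        ∎

  Q-closed : ∀ {½ s w} → (1# + 1#) * ½ ≈ 1# → s * s ≈ 1# - 4 · w → ∀ m →
    Q (2 ℕ.+ m) (neg w) ≈ ½ ^ (2 ℕ.+ m) * ((1# - s) ^ (2 ℕ.+ m) + (1# + s) ^ (2 ℕ.+ m))
  Q-closed {½} {s} {w} 2½≈1 ss≈1-4w m = begin
    Q n (neg w)
      ≈⟨ Q≈x^n+y^n (neg w) x+y≈1 (halfRoot (neg w) 2½≈1 -s-s≈) (halfRoot (neg w) 2½≈1 ss≈) m ⟩
    (½ * (1# - s)) ^ n + (½ * (1# + s)) ^ n
      ≈⟨ +-cong (^-distrib-* ½ (1# - s) n) (^-distrib-* ½ (1# + s) n) ⟩
    ½ ^ n * (1# - s) ^ n + ½ ^ n * (1# + s) ^ n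
      ≈⟨ distribˡ _ _ _ ⟨
    ½ ^ n * ((1# - s) ^ n + (1# + s) ^ n)
      ∎
    where
    n = 2 ℕ.+ m
    ss≈ : s * s ≈ 1# + 4 · neg w
    ss≈ = ≈-trans ss≈1-4w (+-congˡ (begin
      neg (4 · w)       ≈⟨ -1*x≈-x (4 · w) ⟨
      neg 1# * (4 · w)  ≈⟨ ×-comm-* 4 (neg 1#) w ⟩
      4 · (neg 1# * w)  ≈⟨ +-cong e (+-cong e (+-cong e (+-congʳ e))) ⟩
      4 · neg w         ∎))
      where e = -1*x≈-x w
    -s-s≈ : neg s * neg s ≈ 1# + 4 · neg w
    -s-s≈ = ≈-trans (begin
      neg s * neg s                   ≈⟨ *-cong (-1*x≈-x s) (-1*x≈-x s) ⟨
      (neg 1# * s) * (neg 1# * s)     ≈⟨ solve 2 (λ e s → (e :* s) :* (e :* s) := (e :* e) :* (s :* s)) ≈-refl (neg 1#) s ⟩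
      (neg 1# * neg 1#) * (s * s)     ≈⟨ *-congʳ (≈-trans (-1*x≈-x (neg 1#)) (-‿involutive 1#)) ⟩
      1# * (s * s)                    ≈⟨ *-identityˡ _ ⟩
      s * s                           ∎) ss≈
    x+y≈1 : ½ * (1# - s) + ½ * (1# + s) ≈ 1#
    x+y≈1 = begin
      ½ * (1# - s) + ½ * (1# + s)
        -- The variable `s′` stands for `neg s`: the rearrangement uses only semiring laws, and the
        -- cancellation of `s` follows separately.
        ≈⟨ solve 3 (λ t s s′ → t :* (con 1 :+ s′) :+ t :* (con 1 :+ s) := (con 1 :+ con 1) :* t :+ t :* (s :+ s′)) ≈-refl ½ s (neg s) ⟩
      (1# + 1#) * ½ + ½ * (s - s)
        ≈⟨ +-cong 2½≈1 (≈-trans (*-congˡ (-‿inverseʳ s)) (zeroʳ ½)) ⟩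
      1# + 0#
        ≈⟨ +-identityʳ 1# ⟩
      1#
        ∎

mainTheorem2 : ∀ {c ℓ} (R : CommutativeRing c ℓ) (n : ℕ) → 2 ℕ.≤ n → 2 ∣ n →
    let open Evaluation R
        n/2 = n ℕ./ 2
    in
    ((p : ℕ) .{{_ : NonZero (n ℕ.∸ p)}} → 2 ℕ.* p ℕ.≤ n →
      + a n p ℚ./ 1 ≡ (+ n ℚ./ (n ℕ.∸ p)) ℚ.* (+ ((n ℕ.∸ p) C p) ℚ./ 1))
    × ((p : ℕ) → n ℕ.< 2 ℕ.* p → a n p ≡ 0)
    × ((z z⁻¹ : Carrier) → z * z⁻¹ ≈ 1# →
        let S = sum {suc n} (λ p → neg 1# ^ toℕ p * z⁻¹ ^ toℕ p * (a n (toℕ p) · 1#)) in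
        (eval (Phex n) z z⁻¹ ≈ neg 1# ^ n/2 * (z ^ n/2 * S))
        × (z ^ n/2 * S ≈ z ^ n/2 * Q n (neg z⁻¹))
        × ((½ s : Carrier) → (1# + 1#) * ½ ≈ 1# → s * s ≈ 1# - 4 · z⁻¹ →
            z ^ n/2 * Q n (neg z⁻¹) ≈ (z ^ n/2 * ½ ^ n) * ((1# - s) ^ n + (1# + s) ^ n)))
mainTheorem2 R _ 2≤n (divides zero refl) = contradiction 2≤n λ ()
-- The divisibility witness turns `n` into `suc l * 2`, which computes to `2 + l * 2`: the form
-- required both by the pairing of columns and by the results on cycles with at least two nodes.
mainTheorem2 R _ 2≤n (divides m@(suc l) refl) =
  closedForm , vanishing , λ z z⁻¹ zz⁻¹≈1 →
    subst (λ k → eval (Phex n) z z⁻¹ ≈ neg 1# ^ k * (z ^ k * signedSum n z⁻¹)) m≡n/2 (eval-Phex z z⁻¹ zz⁻¹≈1 l) ,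
    *-congˡ (signedSum≈Q n z⁻¹) ,
    λ ½ s 2½≈1 ss≈ → CR.trans (*-congˡ (Q-closed 2½≈1 ss≈ (l ℕ.* 2))) (CR.sym (*-assoc _ _ _))
  where
  open Evaluation R
  open Ring R
  module CR = CommutativeRing R
  open CR using (*-congˡ; *-assoc)
  n = m ℕ.* 2

  m≡n/2 : m ≡ n ℕ./ 2
  m≡n/2 = sym (m*n/n≡m m 2)

  closedForm : (p : ℕ) .{{_ : NonZero (n ℕ.∸ p)}} → 2 ℕ.* p ℕ.≤ n →
    + a n p ℚ./ 1 ≡ (+ n ℚ./ (n ℕ.∸ p)) ℚ.* (+ ((n ℕ.∸ p) C p) ℚ./ 1)
  closedForm p 2p≤n = /1≡/*/1 (a n p) ((n ℕ.∸ p) C p) n (n ℕ.∸ p)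
    (trans (cong (ℕ._* (n ℕ.∸ p)) (a≡cycleCount (l ℕ.* 2) p)) (cycleCount-closed (l ℕ.* 2) p 2p≤n))

  vanishing : (p : ℕ) → n ℕ.< 2 ℕ.* p → a n p ≡ 0
  vanishing p n<2p = trans (a≡cycleCount (l ℕ.* 2) p) (cycleCount-vanishes (l ℕ.* 2) p n<2p)
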